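{- Let $\alpha=(1^{m_1},2^{n_1})$ and $\beta=(1^{m_2},2^{n_2})$ be two compositions of $n$, and assume $m_1+m_2=2k$. Then for every $\pi\in S_3$, \[ D^{n-k}(C_n)=CR(n,k)=K_{(n,n)(1^{2k},2^{n-k})}=|S_{\alpha\beta}(\pi)|. \] In particular, for every $\pi\in S_3$, \[ M_n=K_{((n+1)^2)(1^2,2^n)},\quad R_n=K_{(n^2)(2^n)},\quad M_{2n}=|S_{(1,2^n)(1,2^n)}(\pi)|,\quad R_{2n}=|S_{(2^n)(2^n)}(\pi)|. \]
   Context: Exponent notation: $(1^{a},2^{b})$ is the composition consisting of $a$ entries equal to $1$ followed by $b$ entries equal to $2$; $(n^2)=(n,n)$. $C_n=\frac1{n+1}\binom{2n}{n}$; for a sequence $f_n$, $D(f_n)=f_n-f_{n-1}$, $D^0(f_n)=f_n$, $D^k(f_n)=D(D^{k-1}(f_n))$. $\mathcal{CR}(n,k)$ is the set of lattice paths from $(0,0)$ to $(n+k,0)$ whose first $2k$ steps lie in $\{(1,1),(1,-1)\}$, whose last $n-k$ steps lie in $\{(1,2),(1,0),(1,-2)\}$ with no step $(1,0)$ on the $x$-axis, and which never go below the $x$-axis; $CR(n,k)=|\mathcal{CR}(n,k)|$. $M_n$ is the number of lattice paths from $(0,0)$ to $(n,0)$ with steps in $\{(1,1),(1,0),(1,-1)\}$ never going below the $x$-axis; $R_n$ is the number of those with no step $(1,0)$ on the $x$-axis. $K_{\lambda\mu}$ is the number of semistandard Young tableaux of shape $\lambda$ and type $\mu$. For compositions $\alpha=(\alpha_1,\ldots,\alpha_p)$,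 $\beta=(\beta_1,\ldots,\beta_q)$ of $N$, $S_{\alpha\beta}$ is the set of two-rowed arrays with top row $1^{\alpha_1}\cdots p^{\alpha_p}$ and bottom row $\tau_{11}\cdots\tau_{1\alpha_1}\cdots\tau_{p1}\cdots\tau_{p\alpha_p}$ with $\tau_{i1}\le\cdots\le\tau_{i\alpha_i}$ for each $i$ and bottom multiset $\{1^{\beta_1},\ldots,q^{\beta_q}\}$; $\tau$ avoids $\pi\in S_3$ if there are no $1\le i_1<i_2<i_3\le p$ and $j_1,j_2,j_3$ with $\tau_{i_sj_s}<\tau_{i_tj_t}$ iff $\pi_s<\pi_t$; $S_{\alpha\beta}(\pi)$ is the set of $\pi$-avoiding elements. -}

module Defs where

open import Data.Nat using (ℕ; zero; suc; _+_; _*_; _∸_; _<_; _≤_; _≡ᵇ_)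
open import Data.Nat.Combinatorics using (_C_)
open import Data.Nat.DivMod using (_/_)
open import Data.Integer as ℤ using (ℤ; +_; -[1+_])
open import Data.Fin using (Fin)
import Data.Fin as Fin
open import Data.Fin.Permutation using (Permutation′; _⟨$⟩ʳ_)
open import Data.List using (List; []; _∷_; _++_; map; concatMap; length; replicate; take; drop; foldr; concat; upTo; lookup)
open import Data.List.Relation.Unary.All using (All)
open import Data.List.Relation.Unary.Linked using (Linked)
open import Data.List.Membership.Propositional using (_∈_)
open import Data.Product using (Σ; _×_; ∃)
open import Data.Unit using (⊤)
open import Data.Bool using (true; false)
open import Data.Empty using (⊥)
open import Relation.Nullary using (¬_)
open import Relation.Binary.PropositionalEquality using (_≡_)

-- Counting: `Count P xs c` says that exactly c entries of the list xs
-- satisfy P.  All sets below are finite and are counted as the number of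
-- elements of an explicit (duplicate-free, exhaustive) candidate list
-- satisfying the defining predicate.

data Count {A : Set} (P : A → Set) : List A → ℕ → Set where
  []  : Count P [] 0
  yes : ∀ {x xs c} → P x → Count P xs c → Count P (x ∷ xs) (suc c)
  no  : ∀ {x xs c} → ¬ P x → Count P xs c → Count P (x ∷ xs) c

words : {A : Set} → List A → ℕ → List (List A)
words as zero    = [] ∷ []
words as (suc L) = concatMap (λ a → map (a ∷_) (words as L)) as

fillings : {A : Set} → List A → List ℕ → List (List (List A))
fillings as []       = [] ∷ []
fillings as (l ∷ ls) = concatMap (λ r → map (r ∷_) (fillings as ls)) (words as l)

[1…_] : ℕ → List ℕ
[1… q ] = map suc (upTo q)

occ : ℕ → List ℕ → ℕ
occ v []       = 0
occ v (x ∷ xs) with x ≡ᵇ v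
... | true  = suc (occ v xs)
... | false = occ v xs

catalan : ℕ → ℤ
catalan n = + (((2 * n) C n) / suc n)

-- D(f)_n = f_n - f_{n-1}   (convention f_{-1} = 0; never used below)
D : (ℕ → ℤ) → ℕ → ℤ
D f zero    = f zero
D f (suc n) = f (suc n) ℤ.- f n

D^ : ℕ → (ℕ → ℤ) → ℕ → ℤ
D^ zero    f = f
D^ (suc j) f = D (D^ j f)

-- Lattice paths: a path is the list of y-increments of its steps
-- (every step has x-increment 1).

NeverBelow : ℤ → List ℤ → Set
NeverBelow h []      = ⊤
NeverBelow h (s ∷ p) = (+ 0 ℤ.≤ h ℤ.+ s) × NeverBelow (h ℤ.+ s) p

NoFlatOnAxis : ℤ → List ℤ → Set
NoFlatOnAxis h []      = ⊤
NoFlatOnAxis h (s ∷ p) = ¬ (h ≡ + 0 × s ≡ + 0) × NoFlatOnAxis (h ℤ.+ s) p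

sumℤ : List ℤ → ℤ
sumℤ = foldr ℤ._+_ (+ 0)

allSteps : List ℤ
allSteps = + 2 ∷ + 1 ∷ + 0 ∷ -[1+ 0 ] ∷ -[1+ 1 ] ∷ []

IsCRPath : ℕ → ℕ → List ℤ → Set
IsCRPath n k p =
  length p ≡ n + k ×
  All (_∈ (+ 1 ∷ -[1+ 0 ] ∷ [])) (take (2 * k) p) ×
  All (_∈ (+ 2 ∷ + 0 ∷ -[1+ 1 ] ∷ [])) (drop (2 * k) p) ×
  NoFlatOnAxis (+ 0) p ×
  NeverBelow (+ 0) p ×
  sumℤ p ≡ + 0

CRCount : ℕ → ℕ → ℕ → Set
CRCount n k c = Count (IsCRPath n k) (words allSteps (n + k)) c

IsMotzkin : ℕ → List ℤ → Set
IsMotzkin n p =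
  length p ≡ n ×
  All (_∈ (+ 1 ∷ + 0 ∷ -[1+ 0 ] ∷ [])) p ×
  NeverBelow (+ 0) p ×
  sumℤ p ≡ + 0

MCount : ℕ → ℕ → Set
MCount n c = Count (IsMotzkin n) (words allSteps n) c

IsRiordan : ℕ → List ℤ → Set
IsRiordan n p = IsMotzkin n p × NoFlatOnAxis (+ 0) p

RCount : ℕ → ℕ → Set
RCount n c = Count (IsRiordan n) (words allSteps n) c

-- Semistandard Young tableaux (a tableau = list of rows, top row first)

StrictBelow : List ℕ → List ℕ → Set
StrictBelow _        []       = ⊤
StrictBelow []       (_ ∷ _)  = ⊥
StrictBelow (a ∷ as) (b ∷ bs) = a < b × StrictBelow as bs

HasContent : List ℕ → List ℕ → Set
HasContent μ xs = (i : Fin (length μ)) → occ (suc (Fin.toℕ i)) xs ≡ lookup μ i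

-- T is an SSYT of shape λ and type μ (entries in 1..length μ by the
-- candidate list)
IsSSYT : List ℕ → List ℕ → List (List ℕ) → Set
IsSSYT λ′ μ T =
  map length T ≡ λ′ ×
  All (Linked _≤_) T ×
  Linked StrictBelow T ×
  HasContent μ (concat T)

KCount : List ℕ → List ℕ → ℕ → Set
KCount λ′ μ c = Count (IsSSYT λ′ μ) (fillings [1… length μ ] λ′) c

-- Two-rowed arrays S_{αβ}: the bottom row is given blockwise,
-- τ = (τ_1,…,τ_p), τ_i = (τ_{i1},…,τ_{iα_i}).

IsArray : List ℕ → List ℕ → List (List ℕ) → Set
IsArray α β τ =
  map length τ ≡ α ×
  All (Linked _≤_) τ ×
  HasContent β (concat τ)

-- InBlock τ i v : v = τ_{(i+1) j} for some j (blocks indexed from 0)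
InBlock : List (List ℕ) → ℕ → ℕ → Set
InBlock []      _       _ = ⊥
InBlock (b ∷ τ) zero    v = v ∈ b
InBlock (b ∷ τ) (suc i) v = InBlock τ i v

ContainsPattern : Permutation′ 3 → List (List ℕ) → Set
ContainsPattern π τ =
  Σ (Fin 3 → ℕ) λ i → Σ (Fin 3 → ℕ) λ v →
    i Fin.zero < i (Fin.suc Fin.zero) ×
    i (Fin.suc Fin.zero) < i (Fin.suc (Fin.suc Fin.zero)) ×
    ((s : Fin 3) → InBlock τ (i s) (v s)) ×
    ((s t : Fin 3) → (v s < v t → (π ⟨$⟩ʳ s) Fin.< (π ⟨$⟩ʳ t))
                   × ((π ⟨$⟩ʳ s) Fin.< (π ⟨$⟩ʳ t) → v s < v t))

Avoids : Permutation′ 3 → List (List ℕ) → Set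
Avoids π τ = ¬ ContainsPattern π τ

SCount : List ℕ → List ℕ → Permutation′ 3 → ℕ → Set
SCount α β π c =
  Count (λ τ → IsArray α β τ × Avoids π τ) (fillings [1… length β ] α) c

comp12 : ℕ → ℕ → List ℕ
comp12 a b = replicate a 1 ++ replicate b 2

{-# OPTIONS --safe #-}
module Submission where

-- Let V_c be the irreducible representation of SL₂ of dimension c + 1, and let W(c₁,…,c_r; h) be the
-- multiplicity of the trivial representation in V_h ⊗ V_{c₁} ⊗ ⋯ ⊗ V_{c_r}, computed by the
-- Clebsch–Gordan rule V_{h+1} ⊗ V_{c+1} = V_{h+c+2} ⊕ (V_h ⊗ V_c).  Tensor products commute, so W does not
-- depend on the order of the c_i.  Every number in the theorem is W(1^{2k}, 2^{n-k}; 0).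
--
-- * CR paths, and two-rowed tableaux read by increasing entries, follow the Clebsch–Gordan rule literally.
--   Motzkin paths are walks by twos on odd heights between two steps ±1, Riordan paths are walks by twos
--   on even heights.
-- * V₁ ⊗ V₁ = V₂ ⊕ V₀ gives the recurrence of the iterated differences, and W(1^{2n}; 0) is a ballot number.
-- * For the patterns 123 and 132 remove the rows of an array one at a time.  Let m be the least value used so
--   far.  A value above m can only be the greatest (123), respectively the least (132), of the remaining
--   values above m, so only the number h of those matters, and with columns β₁,…,β_m still at or below m
--   the number of completions is W(β_m,…,β₁,α; h).  Complementing the values and reversing the rows give
--   the other four patterns.

open import Defs
open import Data.Bool using (true; false; T)
open import Data.Empty using (⊥; ⊥-elim)
open import Data.Fin using (Fin; zero; suc; toℕ)
import Data.Fin as Fin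
open import Data.Fin.Permutation using (Permutation′; _⟨$⟩ʳ_; _⟨$⟩ˡ_; inverseˡ)
import Data.Fin.Properties as Finₚ
open import Data.List using (List; []; _∷_; _++_; [_]; length; lookup; concat; concatMap; reverse; replicate; take; drop; map; filter)
open import Data.List.Membership.Propositional using (_∈_)
open import Data.List.Membership.Propositional.Properties using (∈-map⁺; ∈-map⁻; ∈-++⁺ˡ; ∈-++⁺ʳ; ∈-++⁻; ∈-filter⁺; ∈-filter⁻; ∈-concat⁺′; ∈-upTo⁺; ∈-upTo⁻)
open import Data.List.Membership.Propositional.Properties.WithK using (unique∧set⇒bag)
import Data.List.Membership.DecPropositional as DecMembership
open import Data.List.Properties using (unfold-reverse; reverse-++; ++-identityʳ; length-++; length-replicate; ∷-injective; ∷-injectiveʳ; length-reverse; length-map; map-∘; map-cong; map-++; map-replicate; reverse-involutive; concat-++; reverse-map)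
import Data.List.Properties as Listₚ
open import Data.List.Relation.Binary.BagAndSetEquality using (∼bag⇒↭)
open import Data.List.Relation.Binary.Permutation.Propositional using (_↭_; ↭-trans; ↭-sym; ↭-refl)
import Data.List.Relation.Binary.Permutation.Propositional as Perm
open import Data.List.Relation.Binary.Permutation.Propositional.Properties using (↭-length; ↭-reverse; ++⁺; ++-comm)
open import Data.List.Relation.Binary.Pointwise using (Pointwise; []; _∷_)
open import Data.List.Relation.Binary.Sublist.Heterogeneous using (Sublist; []; _∷ʳ_; _∷_; minimum)
open import Data.List.Relation.Binary.Sublist.Heterogeneous.Properties using (reverse⁺)
open import Data.List.Relation.Unary.All using (All; []; _∷_)
import Data.List.Relation.Unary.All as All
import Data.List.Relation.Unary.All.Properties as Allₚ
open import Data.List.Relation.Unary.AllPairs using (AllPairs; []; _∷_)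
open import Data.List.Relation.Unary.Any using (here; there)
import Data.List.Relation.Unary.Any.Properties as Anyₚ
open import Data.List.Relation.Unary.Linked using (Linked; []; [-]; _∷_)
open import Data.List.Relation.Unary.Linked.Properties using (Linked⇒AllPairs; AllPairs⇒Linked)
open import Data.List.Relation.Unary.Unique.Propositional using (Unique)
import Data.List.Relation.Unary.Unique.Propositional.Properties as Uniq
open import Data.Nat using (ℕ; zero; suc; pred; _+_; _*_; _∸_; _≤_; _<_; s≤s; z≤n; _≡ᵇ_; >-nonZero)
open import Data.Nat.Combinatorics using (_C_; nCk+nC[k+1]≡[n+1]C[k+1]; nCn≡1; nC1≡n; nCk≡nC[n∸k]; k>n⇒nCk≡0)
open import Data.Nat.DivMod using (_/_; m*n/n≡m)
open import Data.Nat.ListAction using (sum)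
open import Data.Nat.ListAction.Properties using (sum-↭)
open import Data.Nat.Properties
open import Data.Nat.Tactic.RingSolver using (solve-∀)
open import Data.Product using (Σ; _×_; _,_; proj₁; proj₂; ∃)
open import Data.Sum using (_⊎_; inj₁; inj₂; [_,_]′)
open import Data.Unit using (⊤; tt)
open import Function using (_∘_; id)
open import Function.Bundles using (mk⇔)
open import Relation.Binary using (DecidableEquality; tri<; tri≈; tri>)
open import Relation.Binary.PropositionalEquality as ≡ using (_≡_; refl; sym; cong; cong₂; subst; _≢_; module ≡-Reasoning)
open import Relation.Nullary using (¬_; Dec) renaming (yes to yesᵈ; no to noᵈ)
open import Relation.Nullary.Decidable using (_×-dec_; from-yes)

-- The count of completions cannot close up at h = 0: an entry x at or below m becomes the new least
-- value, and the remaining values between x and m join those above. The induction therefore covers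
-- every h and arbitrary column heights; only the row lengths stay 1 or 2. A row of length 1
-- reflects V_h ⊗ V_1 = V_{h+1} ⊕ V_{h-1}: an entry at or below m gives the first summand, an entry
-- above m the second. A row of length 2 gives V_{h+2}, V_h, V_{h-2} according as 0, 1 or 2 of its
-- entries lie above m. In the top summand the entry is not forced: it is sought by scanning the
-- columns m, ..., 1, and this scan unfolds `W` along the columns. So the columns must stand in
-- front of the row lengths in `W`, whereas the removal of a row asks for its own factor in front.
-- Commutation bridges the two. It is wanted only when one of the factors is V_1 or V_2: V_1 by a
-- direct induction, V_2 by cancelling V_0 from V_1 ⊗ V_1.

-- Cardinalities of finite sets

record Card {A : Set} (P : A → Set) (c : ℕ) : Set where
  field
    elements : List A
    unique   : Unique elements
    sound    : ∀ {x} → x ∈ elements → P x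
    complete : ∀ {x} → P x → x ∈ elements
    size     : length elements ≡ c

card-size : {A : Set} {P : A → Set} {c d : ℕ} → c ≡ d → Card P c → Card P d
card-size refl C = C

card-empty : {A : Set} {P : A → Set} → (∀ x → ¬ P x) → Card P 0
card-empty ¬P = record
  { elements = [] ; unique = [] ; sound = λ () ; complete = λ p → ⊥-elim (¬P _ p) ; size = refl }

card-singleton : {A : Set} {P : A → Set} (x : A) → P x → (∀ y → P y → y ≡ x) → Card P 1
card-singleton x Px only = record
  { elements = x ∷ [] ; unique = [] ∷ [] ; sound = λ { (here refl) → Px }
  ; complete = λ p → here (only _ p) ; size = refl }

card-⊎ : {A : Set} {P Q R : A → Set} {c d : ℕ} →
         (∀ x → R x → P x ⊎ Q x) → (∀ x → P x → R x) → (∀ x → Q x → R x) →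
         (∀ x → P x → ¬ Q x) → Card P c → Card Q d → Card R (c + d)
card-⊎ split inl inr disj C D = record
  { elements = C.elements ++ D.elements
  ; unique   = Uniq.++⁺ C.unique D.unique (λ { (i , j) → disj _ (C.sound i) (D.sound j) })
  ; sound    = λ i → [ inl _ ∘ C.sound , inr _ ∘ D.sound ]′ (∈-++⁻ C.elements i)
  ; complete = λ r → [ ∈-++⁺ˡ ∘ C.complete , ∈-++⁺ʳ C.elements ∘ D.complete ]′ (split _ r)
  ; size     = ≡.trans (length-++ C.elements) (cong₂ _+_ C.size D.size)
  }
  where
  module C = Card C
  module D = Card D

unique-map : {A B : Set} {P : A → Set} {f : A → B} →
             (∀ {x y} → P x → P y → f x ≡ f y → x ≡ y) →
             ∀ {xs} → All P xs → Unique xs → Unique (map f xs)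
unique-map inj []       []       = []
unique-map inj {x ∷ xs} (p ∷ ps) (u ∷ us) = fresh ps u ∷ unique-map inj ps us
  where
  fresh : ∀ {ys} → All _ ys → All (x ≢_) ys → All (_ ≢_) (map _ ys)
  fresh []       []       = []
  fresh (q ∷ qs) (n ∷ ns) = (n ∘ inj p q) ∷ fresh qs ns

-- The maps have to be mutually inverse only on the two sets, so inverses such as `drop 1` may take
-- arbitrary values elsewhere.
card-bij : {A B : Set} {P : A → Set} {Q : B → Set} {c : ℕ} (f : A → B) (g : B → A) →
           (∀ x → P x → Q (f x)) → (∀ y → Q y → P (g y)) →
           (∀ x → P x → g (f x) ≡ x) → (∀ y → Q y → f (g y) ≡ y) →
           Card P c → Card Q c
card-bij {P = P} f g to from gf fg C = record
  { elements = map f C.elements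
  ; unique   = unique-map {P = P} (λ p q e → ≡.trans (sym (gf _ p)) (≡.trans (cong g e) (gf _ q)))
                 (All.tabulate C.sound) C.unique
  ; sound    = λ i → case-map (∈-map⁻ f i)
  ; complete = λ {y} q → subst (_∈ map f C.elements) (fg y q) (∈-map⁺ f (C.complete (from y q)))
  ; size     = ≡.trans (length-map f C.elements) C.size
  }
  where
  module C = Card C
  case-map : ∀ {y} → Σ _ (λ x → x ∈ C.elements × y ≡ f x) → _
  case-map (x , i , refl) = to x (C.sound i)

card-⇔ : {A : Set} {P Q : A → Set} {c : ℕ} → (∀ x → P x → Q x) → (∀ x → Q x → P x) →
         Card P c → Card Q c
card-⇔ to from = card-bij id id to from (λ _ _ → refl) (λ _ _ → refl)

count-filter : {A : Set} {P : A → Set} (P? : ∀ x → Dec (P x)) (xs : List A) →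
               Count P xs (length (filter P? xs))
count-filter P? [] = []
count-filter P? (x ∷ xs) with P? x
... | yesᵈ p = yes p (count-filter P? xs)
... | noᵈ ¬p = no ¬p (count-filter P? xs)

count-⇔ : {A : Set} {P Q : A → Set} {xs : List A} {c : ℕ} →
          (∀ {x} → x ∈ xs → P x → Q x) → (∀ {x} → x ∈ xs → Q x → P x) →
          Count P xs c → Count Q xs c
count-⇔ f g []        = []
count-⇔ f g (yes p C) = yes (f (here refl) p) (count-⇔ (f ∘ there) (g ∘ there) C)
count-⇔ f g (no ¬p C) = no (¬p ∘ g (here refl)) (count-⇔ (f ∘ there) (g ∘ there) C)

-- `Count` is tied to one candidate list, which bijections do not respect; hence the detour through
-- `Card`. Two duplicate-free lists with the same members are permutations of each other, so
-- filtering the candidates by membership in `elements` yields a list of the same length.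
card⇒count : {A : Set} → DecidableEquality A → {P Q : A → Set} {xs : List A} {c : ℕ} →
             Unique xs → (∀ x → P x → x ∈ xs × Q x) → (∀ x → x ∈ xs → Q x → P x) →
             Card P c → Count Q xs c
card⇒count _≟_ {P} {Q} {xs} {c} uxs to from C =
  subst (Count Q xs) same
    (count-⇔ (λ _ i → proj₂ (to _ (C.sound i))) (λ i q → C.complete (from _ i q))
      (count-filter (_∈? C.elements) xs))
  where
  module C = Card C
  open DecMembership _≟_ using (_∈?_)
  same : length (filter (_∈? C.elements) xs) ≡ c
  same = ≡.trans (↭-length (∼bag⇒↭ (unique∧set⇒bag (Uniq.filter⁺ (_∈? C.elements) uxs) C.unique
    (mk⇔ (λ i → proj₂ (∈-filter⁻ (_∈? C.elements) {xs = xs} i))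
         (λ i → ∈-filter⁺ (_∈? C.elements) (proj₁ (to _ (C.sound i))) i))))) C.size

-- The candidate lists

concatMap-∷⁺ : {A : Set} {r : A} {t : List A} {rs : List A} {ts : List (List A)} →
               r ∈ rs → t ∈ ts → (r ∷ t) ∈ concatMap (λ r → map (r ∷_) ts) rs
concatMap-∷⁺ {ts = ts} i j =
  ∈-concat⁺′ (∈-map⁺ _ j) (∈-map⁺ (λ r → map (r ∷_) ts) i)

concatMap-∷⁻ : {A : Set} {s : List A} (rs : List A) {ts : List (List A)} →
               s ∈ concatMap (λ r → map (r ∷_) ts) rs →
               ∃ λ r → ∃ λ t → r ∈ rs × t ∈ ts × s ≡ r ∷ t
concatMap-∷⁻ (r ∷ rs) {ts} i with ∈-++⁻ (map (r ∷_) ts) i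
... | inj₁ j with ∈-map⁻ (r ∷_) j
...   | t , k , e = r , t , here refl , k , e
concatMap-∷⁻ (r ∷ rs) i | inj₂ j with concatMap-∷⁻ rs j
... | q , t , k , l , e = q , t , there k , l , e

unique-concatMap-∷ : {A : Set} {rs : List A} {ts : List (List A)} → Unique rs → Unique ts →
                     Unique (concatMap (λ r → map (r ∷_) ts) rs)
unique-concatMap-∷ [] uts = []
unique-concatMap-∷ {rs = r ∷ rs} {ts} (ur ∷ urs) uts =
  Uniq.++⁺ (Uniq.map⁺ (proj₂ ∘ ∷-injective) uts) (unique-concatMap-∷ urs uts) disj
  where
  disj : ∀ {x} → ¬ (x ∈ map (r ∷_) ts × x ∈ concatMap (λ q → map (q ∷_) ts) rs)
  disj (i , j) with ∈-map⁻ (r ∷_) i | concatMap-∷⁻ rs j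
  ... | _ , _ , refl | _ , _ , k , _ , refl = All.lookup ur k refl

unique-words : {A : Set} {as : List A} → Unique as → ∀ L → Unique (words as L)
unique-words u zero    = [] ∷ []
unique-words u (suc L) = unique-concatMap-∷ u (unique-words u L)

unique-fillings : {A : Set} {as : List A} → Unique as → ∀ ls → Unique (fillings as ls)
unique-fillings u []       = [] ∷ []
unique-fillings u (l ∷ ls) = unique-concatMap-∷ (unique-words u l) (unique-fillings u ls)

∈-words⁺ : {A : Set} {as w : List A} → All (_∈ as) w → w ∈ words as (length w)
∈-words⁺ []       = here refl
∈-words⁺ (i ∷ is) = concatMap-∷⁺ i (∈-words⁺ is)

∈-words⁻ : {A : Set} {as w : List A} (L : ℕ) → w ∈ words as L → All (_∈ as) w
∈-words⁻ zero (here refl) = []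
∈-words⁻ {as = as} (suc L) i with concatMap-∷⁻ as i
... | _ , _ , j , k , refl = j ∷ ∈-words⁻ L k

∈-fillings⁺ : {A : Set} {as : List A} {τ : List (List A)} →
              All (All (_∈ as)) τ → τ ∈ fillings as (map length τ)
∈-fillings⁺ []       = here refl
∈-fillings⁺ (i ∷ is) = concatMap-∷⁺ (∈-words⁺ i) (∈-fillings⁺ is)

∈-fillings⁻ : {A : Set} {as : List A} {τ : List (List A)} (ls : List ℕ) →
              τ ∈ fillings as ls → All (All (_∈ as)) τ
∈-fillings⁻ [] (here refl) = []
∈-fillings⁻ {as = as} (l ∷ ls) i with concatMap-∷⁻ (words as l) i
... | _ , _ , j , k , refl = ∈-words⁻ l j ∷ ∈-fillings⁻ ls k

unique-[1…] : ∀ q → Unique [1… q ]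
unique-[1…] q = Uniq.map⁺ suc-injective (Uniq.upTo⁺ q)

∈-[1…]⁺ : ∀ {q v} → 1 ≤ v → v ≤ q → v ∈ [1… q ]
∈-[1…]⁺ {v = suc v} _ v≤q = ∈-map⁺ suc (∈-upTo⁺ v≤q)

∈-[1…]⁻ : ∀ {q v} → v ∈ [1… q ] → 1 ≤ v × v ≤ q
∈-[1…]⁻ i with ∈-map⁻ suc i
... | _ , j , refl = s≤s z≤n , ∈-upTo⁻ j

-- Clebsch-Gordan multiplicities and their commutation

-- If f h is the multiplicity of V₀ in V_h ⊗ Y, then U c f h is that in V_h ⊗ V_c ⊗ Y.
U : ℕ → (ℕ → ℕ) → ℕ → ℕ
U zero    f h       = f h
U (suc c) f zero    = f (suc c)
U (suc c) f (suc h) = f (suc h + suc c) + U c f h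

W : List ℕ → ℕ → ℕ
W []       zero    = 1
W []       (suc h) = 0
W (c ∷ cs)         = U c (W cs)

U-cong : ∀ c {f g : ℕ → ℕ} → (∀ h → f h ≡ g h) → ∀ h → U c f h ≡ U c g h
U-cong zero    e h       = e h
U-cong (suc c) e zero    = e (suc c)
U-cong (suc c) e (suc h) = cong₂ _+_ (e _) (U-cong c e h)

U-+ : ∀ c (f g : ℕ → ℕ) h → U c (λ x → f x + g x) h ≡ U c f h + U c g h
U-+ zero    f g h       = refl
U-+ (suc c) f g zero    = refl
U-+ (suc c) f g (suc h) =
  ≡.trans (cong ((f (suc h + suc c) + g (suc h + suc c)) +_) (U-+ c f g h))
          (lemma (f (suc h + suc c)) (g (suc h + suc c)) (U c f h) (U c g h))
  where
  lemma : ∀ a b c d → (a + b) + (c + d) ≡ (a + c) + (b + d)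
  lemma = solve-∀

U-zero : ∀ c f → U c f 0 ≡ f c
U-zero zero    f = refl
U-zero (suc c) f = refl

U₁-suc : ∀ f h → U 1 f (suc h) ≡ f (suc (suc h)) + f h
U₁-suc f h = cong (λ x → f x + f h) (+-comm (suc h) 1)

U₂-suc² : ∀ f h → U 2 f (suc (suc h)) ≡ f (4 + h) + (f (2 + h) + f h)
U₂-suc² f h = cong₂ (λ x y → f x + (f y + f h)) (+-comm (2 + h) 2) (+-comm (suc h) 1)

-- Induction lowering c and h together: V_{h+1} ⊗ V_{c+1} exceeds V_h ⊗ V_c by the single summand
-- V_{h+c+2}. On the left two such summands are shed, at h+c+3 and h+c+1, and `lower` collects them;
-- together they are `U 1 f` at h+c+2, the leading term on the right.
U₁-comm : ∀ c f h → U 1 (U c f) h ≡ U c (U 1 f) h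
U₁-comm zero    f h       = refl
U₁-comm (suc c) f zero    =
  ≡.trans (cong (f (suc (suc c)) +_) (U-zero c f)) (sym (U₁-suc f c))
U₁-comm (suc c) f (suc h) = begin
  U 1 (U (suc c) f) (suc h)
    ≡⟨ U₁-suc (U (suc c) f) h ⟩
  f (suc (suc h) + suc c) + U c f (suc h) + U (suc c) f h
    ≡⟨ lower c h ⟩
  f (suc (suc h) + suc c) + f (h + suc c) + U 1 (U c f) h
    ≡⟨ cong₂ _+_ (sym (U₁-suc f (h + suc c))) (U₁-comm c f h) ⟩
  U 1 f (suc h + suc c) + U c (U 1 f) h ∎
  where
  open ≡-Reasoning
  rot : ∀ a b d e → a + b + (d + e) ≡ a + d + (b + e)
  rot = solve-∀
  swp : ∀ a b d → a + b + d ≡ a + d + b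
  swp = solve-∀
  lower : ∀ c h → f (suc (suc h) + suc c) + U c f (suc h) + U (suc c) f h
                  ≡ f (suc (suc h) + suc c) + f (h + suc c) + U 1 (U c f) h
  lower c zero    = swp (f (suc (suc (suc c)))) (U c f 1) (f (suc c))
  lower c (suc h) =
    ≡.trans (rot (f (suc (suc (suc h)) + suc c)) (U c f (suc (suc h))) (f (suc h + suc c)) (U c f h))
      (cong ((f (suc (suc (suc h)) + suc c) + f (suc h + suc c)) +_) (sym (U₁-suc (U c f) h)))

-- V₁ ⊗ V₁ = V₂ ⊕ V₀
U₁U₁ : ∀ f h → U 1 (U 1 f) h ≡ U 2 f h + f h
U₁U₁ f zero          = U₁-suc f 0
U₁U₁ f (suc zero)    = ≡.trans (U₁-suc (U 1 f) 0) (cong (_+ f 1) (U₁-suc f 1))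
U₁U₁ f (suc (suc h)) = begin
  U 1 (U 1 f) (suc (suc h))                       ≡⟨ U₁-suc (U 1 f) (suc h) ⟩
  U 1 f (3 + h) + U 1 f (suc h)                    ≡⟨ cong (_+ U 1 f (suc h)) (U₁-suc f (2 + h)) ⟩
  f (4 + h) + f (2 + h) + U 1 f (suc h)             ≡⟨ swp (f (4 + h)) (f (2 + h)) (U 1 f (suc h)) ⟩
  f (4 + h) + U 1 f (suc h) + f (2 + h)
    ≡⟨ cong (λ x → f x + U 1 f (suc h) + f (2 + h)) (+-comm 2 (2 + h)) ⟩
  U 2 f (suc (suc h)) + f (suc (suc h))             ∎
  where
  open ≡-Reasoning
  swp : ∀ a b d → a + b + d ≡ a + d + b
  swp = solve-∀

-- V₁ ⊗ V₁ commutes with V_c because V₁ does; cancelling the summand V₀ on both sides leaves V₂.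
U₂-comm : ∀ c f h → U 2 (U c f) h ≡ U c (U 2 f) h
U₂-comm c f h = +-cancelʳ-≡ (U c f h) _ _ (begin
  U 2 (U c f) h + U c f h          ≡⟨ sym (U₁U₁ (U c f) h) ⟩
  U 1 (U 1 (U c f)) h              ≡⟨ U-cong 1 (U₁-comm c f) h ⟩
  U 1 (U c (U 1 f)) h              ≡⟨ U₁-comm c (U 1 f) h ⟩
  U c (U 1 (U 1 f)) h              ≡⟨ U-cong c (U₁U₁ f) h ⟩
  U c (λ x → U 2 f x + f x) h      ≡⟨ U-+ c (U 2 f) f h ⟩
  U c (U 2 f) h + U c f h          ∎)
  where open ≡-Reasoning

OneOrTwo : ℕ → Set
OneOrTwo c = c ≡ 1 ⊎ c ≡ 2

U-comm : ∀ {a} → OneOrTwo a → ∀ c f h → U a (U c f) h ≡ U c (U a f) h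
U-comm (inj₁ refl) = U₁-comm
U-comm (inj₂ refl) = U₂-comm

-- The entries of γ are unrestricted: in the count of arrays they are column heights, which sink as
-- far as 0 while copies are used up.
W-pull : ∀ {a} → OneOrTwo a → ∀ γ xs h → W (γ ++ a ∷ xs) h ≡ W (a ∷ γ ++ xs) h
W-pull o []      xs h = refl
W-pull o (c ∷ γ) xs h =
  ≡.trans (U-cong c (W-pull o γ xs) h) (sym (U-comm o c (W (γ ++ xs)) h))

W-↭ : ∀ {xs ys} → All OneOrTwo xs → xs ↭ ys → ∀ h → W xs h ≡ W ys h
W-↭ os p h = proj₁ (go os p) h
  where
  go : ∀ {xs ys} → All OneOrTwo xs → xs ↭ ys → (∀ h → W xs h ≡ W ys h) × All OneOrTwo ys
  go os Perm.refl = (λ _ → refl) , os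
  go (o ∷ os) (Perm.prep a p) with go os p
  ... | e , os′ = U-cong a e , o ∷ os′
  go (o ∷ o′ ∷ os) (Perm.swap a b p) with go os p
  ... | e , os′ = (λ h → ≡.trans (U-cong a (U-cong b e) h) (U-comm o b _ h)) , o′ ∷ o ∷ os′
  go os (Perm.trans p q) with go os p
  ... | e , os′ with go os′ q
  ...   | e′ , os″ = (λ h → ≡.trans (e h) (e′ h)) , os″

-- Tensoring with V_c lowers a highest weight by at most c, so a weight above the total never comes
-- down to 0.
W-vanish : ∀ xs h → sum xs < h → W xs h ≡ 0
W-vanish []       (suc h) _  = refl
W-vanish (c ∷ cs) h       lt = go c h lt
  where
  go : ∀ c h → c + sum cs < h → U c (W cs) h ≡ 0
  go zero    h       lt       = W-vanish cs h lt
  go (suc c) (suc h) (s≤s lt) = cong₂ _+_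
    (W-vanish cs _ (≤-trans (s≤s (≤-trans (m≤n+m _ (suc c)) lt)) (m≤m+n (suc h) (suc c))))
    (go c h lt)

-- Multiplicities for (1^a, 2^b): ballot and Catalan numbers

oneOrTwo-comp12 : ∀ a b → All OneOrTwo (comp12 a b)
oneOrTwo-comp12 zero    zero    = []
oneOrTwo-comp12 zero    (suc b) = inj₂ refl ∷ oneOrTwo-comp12 zero b
oneOrTwo-comp12 (suc a) b       = inj₁ refl ∷ oneOrTwo-comp12 a b

sum-comp12 : ∀ a b → sum (comp12 a b) ≡ a + 2 * b
sum-comp12 zero    zero    = refl
sum-comp12 zero    (suc b) = ≡.trans (cong (2 +_) (sum-comp12 zero b)) (lemma b)
  where
  lemma : ∀ b → 2 + 2 * b ≡ 2 * suc b
  lemma = solve-∀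
sum-comp12 (suc a) b       = cong suc (sum-comp12 a b)

W-comp12-++ : ∀ a b c d h → W (comp12 a b ++ comp12 c d) h ≡ W (comp12 (a + c) (b + d)) h
W-comp12-++ (suc a) b       c       d h = U-cong 1 (W-comp12-++ a b c d) h
W-comp12-++ zero    b       (suc c) d h =
  ≡.trans (W-pull (inj₁ refl) (comp12 0 b) (comp12 c d) h) (U-cong 1 (W-comp12-++ zero b c d) h)
W-comp12-++ zero    zero    zero    d h = refl
W-comp12-++ zero    (suc b) zero    d h = U-cong 2 (W-comp12-++ zero b zero d) h

-- Two leading factors V₁ fuse into V₂ ⊕ V₀, and V₂ moves behind the remaining V₁. Solved for the
-- first summand, this is a difference, the source of the operator `D`.
W-comp12-split : ∀ a b → W (comp12 (2 + a) b) 0 ≡ W (comp12 a (suc b)) 0 + W (comp12 a b) 0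
W-comp12-split a b = ≡.trans (U₁U₁ (W (comp12 a b)) 0)
  (cong (_+ W (comp12 a b) 0) (sym (W-pull (inj₂ refl) (replicate a 1) (replicate b 2) 0)))

W-comp12-top : ∀ N → W (comp12 N 0) N ≡ 1
W-comp12-top zero    = refl
W-comp12-top (suc N) = ≡.trans (U₁-suc (W (comp12 N 0)) N)
  (cong₂ _+_ (W-vanish (comp12 N 0) _ (s≤s (≤-trans (≤-reflexive sum≡N) (n≤1+n N)))) (W-comp12-top N))
  where
  sum≡N : sum (comp12 N 0) ≡ N
  sum≡N = ≡.trans (sum-comp12 N 0) (+-identityʳ N)

nC0≡1 : ∀ n → n C 0 ≡ 1
nC0≡1 n = ≡.trans (nCk≡nC[n∸k] (z≤n {n})) (nCn≡1 n)

-- The reflection formula C(N, d+1) - C(N, d) for walks from height h to 0 with d+1 steps up,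
-- written without subtraction; Pascal's rule carries the induction on N.
ballot : ∀ N h d → N ≡ h + 2 * suc d → W (comp12 N 0) h + N C d ≡ N C suc d
ballot (suc N) zero zero refl = refl
ballot (suc N) zero (suc d) e = begin
  W (comp12 N 0) 1 + suc N C suc d        ≡⟨ cong (_ +_) (sym (nCk+nC[k+1]≡[n+1]C[k+1] N d)) ⟩
  W (comp12 N 0) 1 + (N C d + N C suc d)  ≡⟨ sym (+-assoc (W (comp12 N 0) 1) (N C d) (N C suc d)) ⟩
  W (comp12 N 0) 1 + N C d + N C suc d    ≡⟨ cong (_+ N C suc d) (ballot N 1 d N≡) ⟩
  N C suc d + N C suc d                   ≡⟨ cong (N C suc d +_) middle ⟩
  N C suc d + N C suc (suc d)             ≡⟨ nCk+nC[k+1]≡[n+1]C[k+1] N (suc d) ⟩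
  suc N C suc (suc d)                     ∎
  where
  open ≡-Reasoning
  shape : ∀ d → 2 * suc (suc d) ≡ suc (1 + 2 * suc d)
  shape = solve-∀
  N≡ : N ≡ 1 + 2 * suc d
  N≡ = suc-injective (≡.trans e (shape d))
  shape′ : ∀ d → 1 + 2 * suc d ≡ suc d + suc (suc d)
  shape′ = solve-∀
  N≡′ : N ≡ suc d + suc (suc d)
  N≡′ = ≡.trans N≡ (shape′ d)
  -- N = 2d + 3 is odd, so its two middle binomial coefficients agree; this accounts for the missing
  -- step down from the axis.
  middle : N C suc d ≡ N C suc (suc d)
  middle = ≡.trans (nCk≡nC[n∸k] (≤-trans (m≤m+n (suc d) (suc (suc d))) (≤-reflexive (sym N≡′))))
    (cong (N C_) (≡.trans (cong (_∸ suc d) N≡′) (m+n∸m≡n (suc d) (suc (suc d)))))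
ballot (suc N) (suc h) d e = begin
  W (comp12 (suc N) 0) (suc h) + suc N C d
    ≡⟨ cong (_+ suc N C d) (U₁-suc (W (comp12 N 0)) h) ⟩
  W (comp12 N 0) (2 + h) + W (comp12 N 0) h + suc N C d
    ≡⟨ step d e ⟩
  N C d + N C suc d
    ≡⟨ nCk+nC[k+1]≡[n+1]C[k+1] N d ⟩
  suc N C suc d ∎
  where
  open ≡-Reasoning
  rot : ∀ a b c e → a + b + (c + e) ≡ (a + c) + (b + e)
  rot = solve-∀
  shape : ∀ h d → h + 2 * suc d ≡ (2 + h) + 2 * d
  shape = solve-∀
  step : ∀ d → suc N ≡ suc h + 2 * suc d →
         W (comp12 N 0) (2 + h) + W (comp12 N 0) h + suc N C d ≡ N C d + N C suc d
  -- For d = 0 the height 2 + h equals N, out of reach of the induction hypothesis; there the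
  -- straight descent is the only walk.
  step zero e = begin
    W (comp12 N 0) (2 + h) + W (comp12 N 0) h + suc N C 0
      ≡⟨ cong₂ (λ x y → W (comp12 N 0) x + W (comp12 N 0) h + y) (sym N≡) (≡.trans (nC0≡1 (suc N)) (sym (nC0≡1 N))) ⟩
    W (comp12 N 0) N + W (comp12 N 0) h + N C 0
      ≡⟨ cong (λ x → x + W (comp12 N 0) h + N C 0) (≡.trans (W-comp12-top N) (sym (nC0≡1 N))) ⟩
    N C 0 + W (comp12 N 0) h + N C 0
      ≡⟨ +-assoc (N C 0) (W (comp12 N 0) h) (N C 0) ⟩
    N C 0 + (W (comp12 N 0) h + N C 0)
      ≡⟨ cong (N C 0 +_) (ballot N h 0 (suc-injective e)) ⟩
    N C 0 + N C 1 ∎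
    where
    N≡ : N ≡ 2 + h
    N≡ = ≡.trans (suc-injective e) (≡.trans (shape h 0) (+-identityʳ _))
  step (suc d) e = begin
    W (comp12 N 0) (2 + h) + W (comp12 N 0) h + suc N C suc d
      ≡⟨ cong (_ +_) (sym (nCk+nC[k+1]≡[n+1]C[k+1] N d)) ⟩
    W (comp12 N 0) (2 + h) + W (comp12 N 0) h + (N C d + N C suc d)
      ≡⟨ rot (W (comp12 N 0) (2 + h)) (W (comp12 N 0) h) (N C d) (N C suc d) ⟩
    (W (comp12 N 0) (2 + h) + N C d) + (W (comp12 N 0) h + N C suc d)
      ≡⟨ cong₂ _+_ (ballot N (2 + h) d (≡.trans (suc-injective e) (shape h (suc d))))
                   (ballot N h (suc d) (suc-injective e)) ⟩
    N C suc d + N C suc (suc d) ∎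

[k+1]*[n+1]C[k+1] : ∀ n k → suc k * (suc n C suc k) ≡ suc n * (n C k)
[k+1]*[n+1]C[k+1] zero zero    = refl
[k+1]*[n+1]C[k+1] zero (suc k) =
  ≡.trans (cong (suc (suc k) *_) (k>n⇒nCk≡0 {1} {suc (suc k)} (s≤s (s≤s z≤n))))
          (≡.trans (*-zeroʳ (suc (suc k))) (cong (1 *_) (sym (k>n⇒nCk≡0 {0} {suc k} (s≤s z≤n)))))
[k+1]*[n+1]C[k+1] (suc n) zero = begin
  1 * (suc (suc n) C 1)       ≡⟨ *-identityˡ _ ⟩
  suc (suc n) C 1             ≡⟨ nC1≡n (suc (suc n)) ⟩
  suc (suc n)                 ≡⟨ sym (*-identityʳ _) ⟩
  suc (suc n) * 1             ≡⟨ cong (suc (suc n) *_) (sym (nC0≡1 (suc n))) ⟩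
  suc (suc n) * (suc n C 0)   ∎
  where open ≡-Reasoning
[k+1]*[n+1]C[k+1] (suc n) (suc k) = begin
  suc (suc k) * (suc (suc n) C suc (suc k))
    ≡⟨ cong (suc (suc k) *_) (sym (nCk+nC[k+1]≡[n+1]C[k+1] (suc n) (suc k))) ⟩
  suc (suc k) * (A + B)
    ≡⟨ expand k A B ⟩
  A + suc k * A + suc (suc k) * B
    ≡⟨ cong₂ (λ x y → A + x + y) ([k+1]*[n+1]C[k+1] n k) ([k+1]*[n+1]C[k+1] n (suc k)) ⟩
  A + suc n * (n C k) + suc n * (n C suc k)
    ≡⟨ collect n A (n C k) (n C suc k) ⟩
  A + suc n * (n C k + n C suc k)
    ≡⟨ cong (λ x → A + suc n * x) (nCk+nC[k+1]≡[n+1]C[k+1] n k) ⟩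
  suc (suc n) * A ∎
  where
  open ≡-Reasoning
  A B : ℕ
  A = suc n C suc k
  B = suc n C suc (suc k)
  expand : ∀ k a b → suc (suc k) * (a + b) ≡ a + suc k * a + suc (suc k) * b
  expand = solve-∀
  collect : ∀ n a x y → a + suc n * x + suc n * y ≡ a + suc n * (x + y)
  collect = solve-∀

-- With n = d + 1, A = C(2n, n-1) and B = C(2n, n), the ballot formula gives X = B - A and
-- absorption gives n B = (n+1) A, whence (n+1) X = B. Terms are added to both sides so that all
-- stays in ℕ.
W-catalan : ∀ n → W (comp12 (2 * n) 0) 0 * suc n ≡ (2 * n) C n
W-catalan zero    = refl
W-catalan (suc d) = +-cancelʳ-≡ (X + suc (suc d) * A) _ _ (begin
  X * suc (suc d) + (X + suc (suc d) * A)    ≡⟨ regroup X A d ⟩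
  X + suc (suc d) * (X + A)                  ≡⟨ cong (λ x → X + suc (suc d) * x) (ballot N 0 d refl) ⟩
  X + suc (suc d) * B                        ≡⟨⟩
  X + (B + suc d * B)                        ≡⟨ cong (λ x → X + (B + x)) absorb ⟩
  X + (B + suc (suc d) * A)                  ≡⟨ rot X B (suc (suc d) * A) ⟩
  B + (X + suc (suc d) * A)                  ∎)
  where
  open ≡-Reasoning
  N X A B : ℕ
  N = 2 * suc d
  X = W (comp12 N 0) 0
  A = N C d
  B = N C suc d
  rot : ∀ a b c → a + (b + c) ≡ b + (a + c)
  rot = solve-∀
  regroup : ∀ x a d → x * suc (suc d) + (x + suc (suc d) * a) ≡ x + suc (suc d) * (x + a)
  regroup = solve-∀
  double : ∀ d a → suc (2 * suc d) * a ≡ suc (suc d) * a + suc d * a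
  double = solve-∀
  absorb : suc d * B ≡ suc (suc d) * A
  absorb = +-cancelʳ-≡ (suc d * A) _ _ (begin
    suc d * B + suc d * A         ≡⟨ ≡.trans (+-comm (suc d * B) _) (sym (*-distribˡ-+ (suc d) A B)) ⟩
    suc d * (A + B)               ≡⟨ cong (suc d *_) (nCk+nC[k+1]≡[n+1]C[k+1] N d) ⟩
    suc d * (suc N C suc d)       ≡⟨ [k+1]*[n+1]C[k+1] N d ⟩
    suc N * A                     ≡⟨ double d A ⟩
    suc (suc d) * A + suc d * A   ∎)

-- Multiplicities of values and contents

≡ᵇ-refl : ∀ v → (v ≡ᵇ v) ≡ true
≡ᵇ-refl zero    = refl
≡ᵇ-refl (suc v) = ≡ᵇ-refl v

≢⇒≡ᵇ-false : ∀ {v w} → v ≢ w → (v ≡ᵇ w) ≡ false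
≢⇒≡ᵇ-false {v} {w} v≢w with v ≡ᵇ w in e
... | false = refl
... | true  = ⊥-elim (v≢w (≡ᵇ⇒≡ v w (subst T (sym e) tt)))

occ-∷≡ : ∀ v xs → occ v (v ∷ xs) ≡ suc (occ v xs)
occ-∷≡ v xs rewrite ≡ᵇ-refl v = refl

occ-∷≢ : ∀ {v x} xs → x ≢ v → occ v (x ∷ xs) ≡ occ v xs
occ-∷≢ xs x≢v rewrite ≢⇒≡ᵇ-false x≢v = refl

occ-++ : ∀ v xs ys → occ v (xs ++ ys) ≡ occ v xs + occ v ys
occ-++ v []       ys = refl
occ-++ v (x ∷ xs) ys with x ≡ᵇ v
... | true  = cong suc (occ-++ v xs ys)
... | false = occ-++ v xs ys

∈⇒occ : ∀ {v xs} → v ∈ xs → 1 ≤ occ v xs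
∈⇒occ {v} {_ ∷ xs} (here refl) = ≤-trans (s≤s z≤n) (≤-reflexive (sym (occ-∷≡ v xs)))
∈⇒occ {v} {x ∷ xs} (there i) with x ≡ᵇ v
... | true  = s≤s z≤n
... | false = ∈⇒occ i

occ⇒∈ : ∀ {v} xs → 1 ≤ occ v xs → v ∈ xs
occ⇒∈ {v} (x ∷ xs) le with x ≡ᵇ v in e
... | true  = here (sym (≡ᵇ⇒≡ x v (subst T (sym e) tt)))
... | false = there (occ⇒∈ xs le)

record Content (b : ℕ → ℕ) (xs : List ℕ) : Set where
  constructor content
  field occ≡ : ∀ v → occ v xs ≡ b v

open Content

content-cong : ∀ {b b′ xs} → (∀ v → b v ≡ b′ v) → Content b xs → Content b′ xs
content-cong e c = content (λ v → ≡.trans (occ≡ c v) (e v))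

content-∈ : ∀ {b xs v} → Content b xs → v ∈ xs → 1 ≤ b v
content-∈ c i = ≤-trans (∈⇒occ i) (≤-reflexive (occ≡ c _))

content-∋ : ∀ {b xs v} → Content b xs → 1 ≤ b v → v ∈ xs
content-∋ {xs = xs} c le = occ⇒∈ xs (≤-trans le (≤-reflexive (sym (occ≡ c _))))

dec : ℕ → (ℕ → ℕ) → ℕ → ℕ
dec v b w with v ≡ᵇ w
... | true  = pred (b w)
... | false = b w

dec-≡ : ∀ v b → dec v b v ≡ pred (b v)
dec-≡ v b rewrite ≡ᵇ-refl v = refl

dec-≢ : ∀ {v w} b → v ≢ w → dec v b w ≡ b w
dec-≢ b v≢w rewrite ≢⇒≡ᵇ-false v≢w = refl

dec-≤ : ∀ v b w → dec v b w ≤ b w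
dec-≤ v b w with v ≡ᵇ w
... | true  = pred[n]≤n
... | false = ≤-refl

dec-comm : ∀ v w b u → dec v (dec w b) u ≡ dec w (dec v b) u
dec-comm v w b u with v ≡ᵇ u in e | w ≡ᵇ u in f
... | true  | true  rewrite e | f = refl
... | true  | false rewrite e | f = refl
... | false | true  rewrite e | f = refl
... | false | false rewrite e | f = refl

content-tail : ∀ {b x xs} → Content b (x ∷ xs) → Content (dec x b) xs
content-tail {b} {x} {xs} c = content go
  where
  go : ∀ v → occ v xs ≡ dec x b v
  go v with x ≡ᵇ v | occ≡ c v
  ... | true  | e = cong pred e
  ... | false | e = e

content-∷ : ∀ {b x xs} → 1 ≤ b x → Content (dec x b) xs → Content b (x ∷ xs)
content-∷ {b} {x} {xs} le c = content go
  where
  go : ∀ v → occ v (x ∷ xs) ≡ b v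
  go v with x ≟ v
  ... | yesᵈ refl = ≡.trans (occ-∷≡ x xs)
    (≡.trans (cong suc (≡.trans (occ≡ c x) (dec-≡ x b))) (suc-pred (b x) {{>-nonZero le}}))
  ... | noᵈ x≢v   = ≡.trans (occ-∷≢ xs x≢v) (≡.trans (occ≡ c v) (dec-≢ b x≢v))

Supported : ℕ → (ℕ → ℕ) → Set
Supported q b = ∀ v → 1 ≤ b v → 1 ≤ v × v ≤ q

supported-dec : ∀ {q b} x → Supported q b → Supported q (dec x b)
supported-dec {b = b} x s v le = s v (≤-trans le (dec-≤ x b v))

-- The heights of the columns j, ..., 1, greatest value first: the order in which the count of
-- arrays scans for an entry.
caps : (ℕ → ℕ) → ℕ → List ℕ
caps b zero    = []
caps b (suc j) = b (suc j) ∷ caps b j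

caps-cong : ∀ {b b′} j → (∀ v → 1 ≤ v → v ≤ j → b v ≡ b′ v) → caps b j ≡ caps b′ j
caps-cong zero    e = refl
caps-cong (suc j) e = cong₂ _∷_ (e (suc j) (s≤s z≤n) ≤-refl) (caps-cong j (λ v p q → e v p (m≤n⇒m≤1+n q)))

caps-dec-above : ∀ {x} b j → j < x → caps (dec x b) j ≡ caps b j
caps-dec-above {x} b j j<x = caps-cong j (λ v _ v≤j → dec-≢ {x} b (λ { refl → <⇒≱ j<x v≤j }))

sum-caps-dec : ∀ {x} b j → 1 ≤ x → x ≤ j → 1 ≤ b x → sum (caps b j) ≡ suc (sum (caps (dec x b) j))
sum-caps-dec {x} b zero (s≤s _) () le
sum-caps-dec {x} b (suc j) 1≤x x≤j le with x ≟ suc j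
... | yesᵈ refl = cong₂ _+_
  (≡.trans (sym (suc-pred (b (suc j)) {{>-nonZero le}})) (cong suc (sym (dec-≡ (suc j) b))))
  (cong sum (sym (caps-dec-above {suc j} b j (n<1+n j))))
... | noᵈ x≢ = ≡.trans (cong (b (suc j) +_) (sum-caps-dec b j 1≤x (m<1+n⇒m≤n (≤∧≢⇒< x≤j x≢)) le))
  (≡.trans (+-suc (b (suc j)) _) (cong (λ y → suc (y + sum (caps (dec x b) j))) (sym (dec-≢ b x≢))))

sum-caps-zero : ∀ b j → (∀ v → b v ≡ 0) → sum (caps b j) ≡ 0
sum-caps-zero b zero    z = refl
sum-caps-zero b (suc j) z = cong₂ _+_ (z (suc j)) (sum-caps-zero b j z)

sum-caps-content : ∀ {q b} xs → Supported q b → Content b xs → sum (caps b q) ≡ length xs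
sum-caps-content {q} {b} [] s c = sum-caps-zero b q (λ v → sym (occ≡ c v))
sum-caps-content {q} {b} (x ∷ xs) s c =
  ≡.trans (sum-caps-dec b q (proj₁ (s x le)) (proj₂ (s x le)) le)
    (cong suc (sum-caps-content xs (supported-dec {b = b} x s) (content-tail c)))
  where
  le : 1 ≤ b x
  le = content-∈ c (here refl)

caps-snoc : ∀ b j → caps b (suc j) ≡ caps (b ∘ suc) j ++ [ b 1 ]
caps-snoc b zero    = refl
caps-snoc b (suc j) = cong (b (suc (suc j)) ∷_) (caps-snoc b j)

caps-flip : ∀ b q → caps (λ v → b (suc q ∸ v)) q ≡ reverse (caps b q)
caps-flip b zero    = refl
caps-flip b (suc q) = begin
  b (suc q ∸ q) ∷ caps (λ v → b (suc (suc q) ∸ v)) q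
    ≡⟨ cong₂ (λ x y → b x ∷ y) (m+n∸n≡m 1 q) (caps-cong q (λ v _ v≤q → cong b (+-∸-assoc 1 (m≤n⇒m≤1+n v≤q)))) ⟩
  b 1 ∷ caps (λ v → b (suc (suc q ∸ v))) q
    ≡⟨ cong (b 1 ∷_) (caps-flip (b ∘ suc) q) ⟩
  b 1 ∷ reverse (caps (b ∘ suc) q)
    ≡⟨ sym (reverse-++ (caps (b ∘ suc) q) [ b 1 ]) ⟩
  reverse (caps (b ∘ suc) q ++ [ b 1 ])
    ≡⟨ cong reverse (sym (caps-snoc b q)) ⟩
  reverse (caps b (suc q)) ∎
  where open ≡-Reasoning

-- Content function of type μ when its parts are labelled i, i + 1, ….
cont : ℕ → List ℕ → ℕ → ℕ
cont i []      v = 0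
cont i (c ∷ μ) v with i ≡ᵇ v
... | true  = c
... | false = cont (suc i) μ v

cont-≡ : ∀ i c μ → cont i (c ∷ μ) i ≡ c
cont-≡ i c μ rewrite ≡ᵇ-refl i = refl

cont-≢ : ∀ {i v} c μ → i ≢ v → cont i (c ∷ μ) v ≡ cont (suc i) μ v
cont-≢ c μ i≢v rewrite ≢⇒≡ᵇ-false i≢v = refl

cont-shift : ∀ i μ v → cont (suc i) μ (suc v) ≡ cont i μ v
cont-shift i []      v = refl
cont-shift i (c ∷ μ) v with i ≡ᵇ v
... | true  = refl
... | false = cont-shift (suc i) μ v

cont-range : ∀ i μ v → 1 ≤ cont i μ v → i ≤ v × v < i + length μ
cont-range i (c ∷ μ) v le with i ≟ v
... | yesᵈ refl = ≤-refl , m<m+n i (s≤s z≤n)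
... | noᵈ i≢v with cont-range (suc i) μ v (≤-trans le (≤-reflexive (cont-≢ c μ i≢v)))
...   | lo , hi = <⇒≤ lo , ≤-trans hi (≤-reflexive (sym (+-suc i (length μ))))

cont-below : ∀ {i v} μ → v < i → cont i μ v ≡ 0
cont-below {i} {v} μ v<i with cont i μ v in e
... | zero  = refl
... | suc _ = ⊥-elim (<⇒≱ v<i (proj₁ (cont-range i μ v (≤-trans (s≤s z≤n) (≤-reflexive (sym e))))))

cont-supported : ∀ μ → Supported (length μ) (cont 1 μ)
cont-supported μ v le with cont-range 1 μ v le
... | lo , hi = lo , m<1+n⇒m≤n hi

cont-lookup : ∀ i μ (j : Fin (length μ)) → cont i μ (i + toℕ j) ≡ lookup μ j
cont-lookup i (c ∷ μ) zero    rewrite +-identityʳ i = cont-≡ i c μ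
cont-lookup i (c ∷ μ) (suc j) = ≡.trans (cont-≢ c μ (m≢1+m+n i ∘ λ e → ≡.trans e (+-suc i (toℕ j))))
  (≡.trans (cong (cont (suc i) μ) (+-suc i (toℕ j))) (cont-lookup (suc i) μ j))

caps-cont : ∀ μ → caps (cont 1 μ) (length μ) ≡ reverse μ
caps-cont []      = refl
caps-cont (c ∷ μ) = ≡.trans (caps-snoc (cont 1 (c ∷ μ)) (length μ)) (≡.trans
  (cong (_++ [ c ]) (≡.trans (caps-cong (length μ) (λ { (suc v) _ _ → cont-shift 1 μ (suc v) })) (caps-cont μ)))
  (sym (unfold-reverse c μ)))

InRange : ℕ → List ℕ → Set
InRange q = All (_∈ [1… q ])

-- `HasContent` speaks of the labels 1, ..., `length μ` alone; the range of the entries, known from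
-- the candidate list, makes all other multiplicities 0.
hasContent⇒content : ∀ μ xs → InRange (length μ) xs → HasContent μ xs → Content (cont 1 μ) xs
hasContent⇒content μ xs range hc = content go
  where
  go : ∀ v → occ v xs ≡ cont 1 μ v
  go v with (1 ≤? v) ×-dec (v ≤? length μ)
  ... | noᵈ out = outside
    where
    outside : occ v xs ≡ cont 1 μ v
    outside with occ v xs in e | cont 1 μ v in f
    ... | zero  | zero  = refl
    ... | suc _ | _     = ⊥-elim (out (∈-[1…]⁻ (All.lookup range (occ⇒∈ xs (subst (1 ≤_) (sym e) (s≤s z≤n))))))
    ... | zero  | suc _ = ⊥-elim (out (cont-supported μ v (subst (1 ≤_) (sym f) (s≤s z≤n))))
  ... | yesᵈ (s≤s {n = v′} _ , v≤) = begin
    occ (suc v′) xs                 ≡⟨ cong (λ x → occ (suc x) xs) (sym (Finₚ.toℕ-fromℕ< v≤)) ⟩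
    occ (suc (toℕ j)) xs            ≡⟨ hc j ⟩
    lookup μ j                      ≡⟨ sym (cont-lookup 1 μ j) ⟩
    cont 1 μ (suc (toℕ j))          ≡⟨ cong (λ x → cont 1 μ (suc x)) (Finₚ.toℕ-fromℕ< v≤) ⟩
    cont 1 μ (suc v′)               ∎
    where
    open ≡-Reasoning
    j : Fin (length μ)
    j = Fin.fromℕ< v≤

content⇒hasContent : ∀ μ {xs} → Content (cont 1 μ) xs → HasContent μ xs
content⇒hasContent μ c j = ≡.trans (occ≡ c (suc (toℕ j))) (cont-lookup 1 μ j)

content⇒inRange : ∀ {q b xs} → Supported q b → Content b xs → InRange q xs
content⇒inRange s c = All.tabulate (λ i → let lo , hi = s _ (content-∈ c i) in ∈-[1…]⁺ lo hi)

-- Two-rowed tableaux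

Sorted : List ℕ → Set
Sorted = AllPairs _≤_

Rows : Set
Rows = List ℕ × List ℕ

-- The two rows of a tableau after the entries smaller than the current one have been removed,
-- leaving h entries of the first row not yet covered; those count as zeros.
record Tab (b : ℕ → ℕ) (h : ℕ) (r : Rows) : Set where
  constructor tab
  field
    sorted₁ : Sorted (proj₁ r)
    sorted₂ : Sorted (proj₂ r)
    columns : StrictBelow (replicate h 0 ++ proj₁ r) (proj₂ r)
    lengths : h + length (proj₁ r) ≡ length (proj₂ r)
    entries : ∀ v → occ v (proj₁ r) + occ v (proj₂ r) ≡ b v

open Tab

tab-bound : ∀ {i μ h r} → Tab (cont i μ) h r → All (i ≤_) (proj₁ r) × All (i ≤_) (proj₂ r)
tab-bound {i} {μ} {r = r₁ , r₂} t = All.tabulate (λ {v} p → low (≤-trans (∈⇒occ p) (m≤m+n (occ v r₁) (occ v r₂)))) ,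
              All.tabulate (λ {v} p → low (≤-trans (∈⇒occ p) (m≤n+m (occ v r₂) (occ v r₁))))
  where
  low : ∀ {v} → 1 ≤ occ v r₁ + occ v r₂ → i ≤ v
  low {v} le = proj₁ (cont-range i μ v (≤-trans le (≤-reflexive (entries t v))))

occ-zero : ∀ {v xs} → ¬ v ∈ xs → occ v xs ≡ 0
occ-zero {v} {xs} v∉ with occ v xs in e
... | zero  = refl
... | suc _ = ⊥-elim (v∉ (occ⇒∈ xs (subst (1 ≤_) (sym e) (s≤s z≤n))))

above⇒occ-zero : ∀ {v xs} → All (v <_) xs → occ v xs ≡ 0
above⇒occ-zero a = occ-zero (λ p → <-irrefl refl (All.lookup a p))

occ-zero⇒above : ∀ {i xs} → All (i ≤_) xs → occ i xs ≡ 0 → All (i <_) xs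
occ-zero⇒above {i} {xs} le e = All.tabulate (λ {v} p → ≤∧≢⇒< (All.lookup le p) (λ { refl → n≮0 (subst (1 ≤_) e (∈⇒occ p)) }))

sorted-front : ∀ {i} c xs → Sorted xs → All (i ≤_) xs → occ i xs ≡ c →
               xs ≡ replicate c i ++ drop c xs × Sorted (drop c xs) × All (i <_) (drop c xs)
sorted-front zero    xs s le e = refl , s , occ-zero⇒above le e
sorted-front {i} (suc c) (x ∷ xs) (a ∷ s) (le ∷ les) e with x ≟ i
... | yesᵈ refl with sorted-front c xs s les (suc-injective (≡.trans (sym (occ-∷≡ i xs)) e))
...   | eq , s′ , above = cong (i ∷_) eq , s′ , above
sorted-front {i} (suc c) (x ∷ xs) (a ∷ s) (le ∷ les) e | noᵈ x≢i =
  ⊥-elim (0≢1+n (≡.trans (sym (above⇒occ-zero (i<x ∷ All.map (<-≤-trans i<x) a))) e))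
  where
  i<x : i < x
  i<x = ≤∧≢⇒< le (x≢i ∘ sym)

sorted-replicate : ∀ {i} c {xs} → Sorted xs → All (i ≤_) xs → Sorted (replicate c i ++ xs)
sorted-replicate zero    s le = s
sorted-replicate (suc c) s le = Allₚ.++⁺ (Allₚ.replicate⁺ c ≤-refl) le ∷ sorted-replicate c s le

occ-replicate-≡ : ∀ i c xs → occ i (replicate c i ++ xs) ≡ c + occ i xs
occ-replicate-≡ i zero    xs = refl
occ-replicate-≡ i (suc c) xs = ≡.trans (occ-∷≡ i _) (cong suc (occ-replicate-≡ i c xs))

occ-replicate-≢ : ∀ {i v} c xs → i ≢ v → occ v (replicate c i ++ xs) ≡ occ v xs
occ-replicate-≢ zero    xs i≢v = refl
occ-replicate-≢ (suc c) xs i≢v = ≡.trans (occ-∷≢ _ i≢v) (occ-replicate-≢ c xs i≢v)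

replicate-+ : ∀ (v : ℕ) a b xs → replicate (a + b) v ++ xs ≡ replicate a v ++ (replicate b v ++ xs)
replicate-+ v zero    b xs = refl
replicate-+ v (suc a) b xs = cong (v ∷_) (replicate-+ v a b xs)

drop-replicate : ∀ (v : ℕ) c xs → drop c (replicate c v ++ xs) ≡ xs
drop-replicate v zero    xs = refl
drop-replicate v (suc c) xs = drop-replicate v c xs

-- Copies of i in the first row and zeros marking uncovered places are interchangeable once the
-- second row exceeds both; this is used in either direction.
strictBelow-lower : ∀ {x y} h c {r₁ r₂} → All (y <_) r₂ →
  StrictBelow (replicate h 0 ++ (replicate c x ++ r₁)) r₂ →
  StrictBelow (replicate h 0 ++ (replicate c y ++ r₁)) r₂
strictBelow-lower h       c       {r₂ = []}    a       s       = tt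
strictBelow-lower (suc h) c       {r₂ = _ ∷ _} (_ ∷ a) (l , s) = l , strictBelow-lower h c a s
strictBelow-lower zero    (suc c) {r₂ = _ ∷ _} (y ∷ a) (l , s) = y , strictBelow-lower zero c a s
strictBelow-lower zero    zero    {r₂ = _ ∷ _} a       s       = s

module _ (i : ℕ) (1≤i : 1 ≤ i) (c : ℕ) (μ : List ℕ) where

  -- All c copies of i lie in the first row. Nothing covers them yet, so they join the h uncovered
  -- places: the summand V_{h+c}.
  NoSecond : ℕ → Rows → Set
  NoSecond h r = Tab (cont i (c ∷ μ)) h r × occ i (proj₂ r) ≡ 0

  card-noSecond : ∀ {h d} → Card (Tab (cont (suc i) μ) (h + c)) d → Card (NoSecond h) d
  card-noSecond {h} = card-bij (λ { (r₁ , r₂) → replicate c i ++ r₁ , r₂ }) (λ { (r₁ , r₂) → drop c r₁ , r₂ })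
    to from (λ { (r₁ , r₂) _ → cong (_, r₂) (drop-replicate i c r₁) })
    (λ { (r₁ , r₂) x → cong (_, r₂) (sym (proj₁ (front r₁ r₂ x))) })
    where
    front : ∀ r₁ r₂ → NoSecond h (r₁ , r₂) →
            r₁ ≡ replicate c i ++ drop c r₁ × Sorted (drop c r₁) × All (i <_) (drop c r₁)
    front r₁ r₂ (t , no₂) = sorted-front c r₁ (sorted₁ t) (proj₁ (tab-bound {μ = c ∷ μ} t))
      (≡.trans (sym (+-identityʳ _)) (≡.trans (cong (occ i r₁ +_) (sym no₂)) (≡.trans (entries t i) (cont-≡ i c μ))))
    len : ∀ xs → h + length (replicate c i ++ xs) ≡ (h + c) + length xs
    len xs = ≡.trans (cong (h +_) (≡.trans (length-++ (replicate c i)) (cong (_+ length xs) (length-replicate c))))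
      (sym (+-assoc h c (length xs)))
    to : ∀ r → Tab (cont (suc i) μ) (h + c) r → NoSecond h (replicate c i ++ proj₁ r , proj₂ r)
    to (r₁ , r₂) t = tab (sorted-replicate c (sorted₁ t) (All.map <⇒≤ b₁)) (sorted₂ t)
        (strictBelow-lower h c b₂ (subst (λ x → StrictBelow x r₂) (replicate-+ 0 h c r₁) (columns t)))
        (≡.trans (len r₁) (lengths t)) ent , above⇒occ-zero b₂
      where
      b₁ = proj₁ (tab-bound {μ = μ} t)
      b₂ = proj₂ (tab-bound {μ = μ} t)
      ent : ∀ v → occ v (replicate c i ++ r₁) + occ v r₂ ≡ cont i (c ∷ μ) v
      ent v with i ≟ v
      ... | yesᵈ refl rewrite occ-replicate-≡ i c r₁ | above⇒occ-zero b₁ | above⇒occ-zero b₂ | cont-≡ i c μ =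
        ≡.trans (+-identityʳ _) (+-identityʳ c)
      ... | noᵈ i≢v = ≡.trans (cong (_+ occ v r₂) (occ-replicate-≢ c r₁ i≢v)) (≡.trans (entries t v) (sym (cont-≢ c μ i≢v)))
    from : ∀ r → NoSecond h r → Tab (cont (suc i) μ) (h + c) (drop c (proj₁ r) , proj₂ r)
    from (r₁ , r₂) x@(t , no₂) with front r₁ r₂ x
    ... | eq , s , above = tab s (sorted₂ t)
        (subst (λ x → StrictBelow x r₂) (sym (replicate-+ 0 h c (drop c r₁)))
          (strictBelow-lower h c b₂ (subst (λ x → StrictBelow (replicate h 0 ++ x) r₂) eq (columns t))))
        (≡.trans (sym (len (drop c r₁))) (≡.trans (cong (λ x → h + length x) (sym eq)) (lengths t))) ent
      where
      b₂ : All (0 <_) r₂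
      b₂ = All.map (≤-trans 1≤i) (proj₂ (tab-bound {μ = c ∷ μ} t))
      ent : ∀ v → occ v (drop c r₁) + occ v r₂ ≡ cont (suc i) μ v
      ent v with i ≟ v
      ... | yesᵈ refl = ≡.trans (cong₂ _+_ (above⇒occ-zero above) no₂) (sym (cont-below μ (n<1+n i)))
      ... | noᵈ i≢v = ≡.trans (cong (_+ occ v r₂) (≡.trans (sym (occ-replicate-≢ c (drop c r₁) i≢v)) (cong (occ v) (sym eq))))
                        (≡.trans (entries t v) (cont-≢ c μ i≢v))

  -- A leading i of the second row covers the first zero. Here h and c are the values after both
  -- have been removed, as V_h ⊗ V_c sits inside V_{h+1} ⊗ V_{c+1}.
  Second : ℕ → Rows → Set
  Second h r = ∃ λ r₂ → proj₂ r ≡ i ∷ r₂ × Tab (cont i (c ∷ μ)) h (proj₁ r , r₂)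

  card-second : ∀ {h d} → Card (Tab (cont i (c ∷ μ)) h) d → Card (Second h) d
  card-second = card-bij (λ { (r₁ , r₂) → r₁ , i ∷ r₂ }) (λ { (r₁ , r₂) → r₁ , drop 1 r₂ })
    (λ { (r₁ , r₂) t → r₂ , refl , t }) (λ { (r₁ , _) (r₂ , refl , t) → t })
    (λ _ _ → refl) (λ { (r₁ , _) (r₂ , refl , t) → refl })

  second⇒tab : ∀ {h r} → Second h r → Tab (cont i (suc c ∷ μ)) (suc h) r
  second⇒tab {r = r₁ , _} (r₂ , refl , t) = tab (sorted₁ t) (proj₂ (tab-bound {μ = c ∷ μ} t) ∷ sorted₂ t)
    (1≤i , columns t) (cong suc (lengths t)) ent
    where
    ent : ∀ v → occ v r₁ + occ v (i ∷ r₂) ≡ cont i (suc c ∷ μ) v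
    ent v with i ≡ᵇ v | entries t v
    ... | true  | e = ≡.trans (+-suc (occ v r₁) (occ v r₂)) (cong suc e)
    ... | false | e = e

  tab⇒second : ∀ {h r₁ r₂} → Tab (cont i (suc c ∷ μ)) (suc h) (r₁ , i ∷ r₂) → Tab (cont i (c ∷ μ)) h (r₁ , r₂)
  tab⇒second {h} {r₁} {r₂} (tab s₁ (_ ∷ s₂) (_ , col) len e) = tab s₁ s₂ col (suc-injective len) ent
    where
    ent : ∀ v → occ v r₁ + occ v r₂ ≡ cont i (c ∷ μ) v
    ent v with i ≡ᵇ v | e v
    ... | true  | e = suc-injective (≡.trans (sym (+-suc (occ v r₁) (occ v r₂))) e)
    ... | false | e = e

tab-cases : ∀ {i c μ h} r → Tab (cont i (c ∷ μ)) h r → (∃ λ r₂ → proj₂ r ≡ i ∷ r₂) ⊎ occ i (proj₂ r) ≡ 0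
tab-cases (r₁ , [])     t = inj₂ refl
tab-cases {i} {c} {μ} (r₁ , x ∷ r₂) t with x ≟ i | sorted₂ t | proj₂ (tab-bound {μ = c ∷ μ} t)
... | yesᵈ refl | _     | _      = inj₁ (r₂ , refl)
... | noᵈ x≢i   | a ∷ _ | le ∷ _ = inj₂ (above⇒occ-zero (i<x ∷ All.map (<-≤-trans i<x) a))
  where
  i<x : i < x
  i<x = ≤∧≢⇒< le (x≢i ∘ sym)

card-Tab : ∀ μ i → 1 ≤ i → ∀ h → Card (Tab (cont i μ) h) (W μ h)
card-Tab [] i 1≤i h = base h
  where
  none : ∀ {h r₁ r₂} → Tab (cont i []) h (r₁ , r₂) → r₁ ≡ [] × r₂ ≡ []
  none {r₁ = []}    {[]}    t = refl , refl
  none {r₁ = x ∷ r} {r₂}    t = ⊥-elim (n≮0 (≤-trans (∈⇒occ {x} {x ∷ r} (here refl)) (≤-trans (m≤m+n _ (occ x r₂)) (≤-reflexive (entries t x)))))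
  none {r₁ = []}    {x ∷ r} t = ⊥-elim (n≮0 (≤-trans (∈⇒occ {x} {x ∷ r} (here refl)) (≤-reflexive (entries t x))))
  base : ∀ h → Card (Tab (cont i []) h) (W [] h)
  base zero = card-singleton ([] , []) (tab [] [] tt refl (λ _ → refl))
    (λ { (r₁ , r₂) t → let e₁ , e₂ = none t in cong₂ _,_ e₁ e₂ })
  base (suc h) = card-empty absurd
    where
    absurd : ∀ r → ¬ Tab (cont i []) (suc h) r
    absurd (r₁ , r₂) t with none t | lengths t
    ... | refl , refl | ()
card-Tab (c ∷ μ) i 1≤i h = go c h
  where
  IH : ∀ h → Card (Tab (cont (suc i) μ) h) (W μ h)
  IH = card-Tab μ (suc i) (s≤s z≤n)
  go : ∀ c h → Card (Tab (cont i (c ∷ μ)) h) (U c (W μ) h)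
  go zero h = card-⇔ (λ _ → proj₁) (λ r t → t , m+n≡0⇒n≡0 (occ i (proj₁ r)) (≡.trans (entries t i) (cont-≡ i 0 μ)))
    (card-noSecond i 1≤i 0 μ (card-size (cong (W μ) (+-identityʳ h)) (IH (h + 0))))
  -- With nothing left uncovered, an i in the second row would need a smaller entry above it, in a
  -- first row whose entries are at least i.
  go (suc c) zero = card-⇔ (λ _ → proj₁) no₂ (card-noSecond i 1≤i (suc c) μ (IH (suc c)))
    where
    no₂ : ∀ r → Tab (cont i (suc c ∷ μ)) 0 r → NoSecond i 1≤i (suc c) μ 0 r
    no₂ r@(r₁ , _) t with tab-cases {μ = μ} r t
    ... | inj₂ e = t , e
    ... | inj₁ (r₂ , refl) = ⊥-elim (uncovered r₁ (columns t) (proj₁ (tab-bound {μ = suc c ∷ μ} t)))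
      where
      uncovered : ∀ r₁ → StrictBelow r₁ (i ∷ r₂) → ¬ All (i ≤_) r₁
      uncovered (_ ∷ _) (x<i , _) (i≤x ∷ _) = <⇒≱ x<i i≤x
  go (suc c) (suc h) = card-⊎ {P = NoSecond i 1≤i (suc c) μ (suc h)} {Q = Second i 1≤i c μ h}
    split (λ _ → proj₁) (λ _ → second⇒tab i 1≤i c μ) disj
    (card-noSecond i 1≤i (suc c) μ (IH (suc h + suc c))) (card-second i 1≤i c μ (go c h))
    where
    split : ∀ r → Tab (cont i (suc c ∷ μ)) (suc h) r → NoSecond i 1≤i (suc c) μ (suc h) r ⊎ Second i 1≤i c μ h r
    split r@(r₁ , _) t with tab-cases {μ = μ} r t
    ... | inj₂ e           = inj₁ (t , e)
    ... | inj₁ (r₂ , refl) = inj₂ (r₂ , refl , tab⇒second i 1≤i c μ t)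
    disj : ∀ r → NoSecond i 1≤i (suc c) μ (suc h) r → ¬ Second i 1≤i c μ h r
    disj (r₁ , _) (_ , e) (r₂ , refl , _) = 0≢1+n (≡.trans (sym e) (occ-∷≡ i r₂))

-- The recursion only makes the two rows equally long; the total 2n then fixes both lengths as n.
count-K : ∀ n μ → sum μ ≡ n + n → KCount (n ∷ n ∷ []) μ (W μ 0)
count-K n μ sum≡ = card⇒count (Listₚ.≡-dec (Listₚ.≡-dec _≟_))
  (unique-fillings (unique-[1…] (length μ)) (n ∷ n ∷ [])) to from
  (card-bij {Q = Tableau} (λ { (r₁ , r₂) → r₁ ∷ r₂ ∷ [] }) rows
    (λ _ t → _ , refl , t) (λ { _ (_ , refl , t) → t }) (λ _ _ → refl) (λ { _ (_ , refl , _) → refl })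
    (card-Tab μ 1 (s≤s z≤n) 0))
  where
  Tableau : List (List ℕ) → Set
  Tableau T = ∃ λ (r : Rows) → T ≡ proj₁ r ∷ proj₂ r ∷ [] × Tab (cont 1 μ) 0 r
  rows : List (List ℕ) → Rows
  rows (r₁ ∷ r₂ ∷ _) = r₁ , r₂
  rows _             = [] , []
  occ-concat : ∀ v r₁ r₂ → occ v (r₁ ++ (r₂ ++ [])) ≡ occ v r₁ + occ v r₂
  occ-concat v r₁ r₂ = ≡.trans (cong (λ x → occ v (r₁ ++ x)) (++-identityʳ r₂)) (occ-++ v r₁ r₂)
  to : ∀ T → Tableau T → T ∈ fillings [1… length μ ] (n ∷ n ∷ []) × IsSSYT (n ∷ n ∷ []) μ T
  to T ((r₁ , r₂) , refl , t) =
    subst (λ x → T ∈ fillings [1… length μ ] x) shape (∈-fillings⁺ (range₁ ∷ range₂ ∷ [])) ,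
    (shape , AllPairs⇒Linked (sorted₁ t) ∷ AllPairs⇒Linked (sorted₂ t) ∷ [] , columns t ∷ [-] ,
     content⇒hasContent μ cnt)
    where
    cnt : Content (cont 1 μ) (concat T)
    cnt = content (λ v → ≡.trans (occ-concat v r₁ r₂) (entries t v))
    range : InRange (length μ) (concat T)
    range = content⇒inRange (cont-supported μ) cnt
    range₁ = Allₚ.++⁻ˡ r₁ range
    range₂ = Allₚ.++⁻ˡ r₂ (Allₚ.++⁻ʳ r₁ range)
    total : length r₁ + length r₁ ≡ n + n
    total = begin
      length r₁ + length r₁                       ≡⟨ cong (length r₁ +_) (lengths t) ⟩
      length r₁ + length r₂                       ≡⟨ sym (length-++ r₁) ⟩
      length (r₁ ++ r₂)                           ≡⟨ cong (λ x → length (r₁ ++ x)) (sym (++-identityʳ r₂)) ⟩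
      length (concat T)                           ≡⟨ sym (sum-caps-content _ (cont-supported μ) cnt) ⟩
      sum (caps (cont 1 μ) (length μ))             ≡⟨ cong sum (caps-cont μ) ⟩
      sum (reverse μ)                             ≡⟨ sum-↭ (↭-reverse μ) ⟩
      sum μ                                       ≡⟨ sum≡ ⟩
      n + n                                       ∎
      where open ≡-Reasoning
    length₁ : length r₁ ≡ n
    length₁ = halve (length r₁) n total
      where
      halve : ∀ a b → a + a ≡ b + b → a ≡ b
      halve zero    zero    e = refl
      halve (suc a) (suc b) e =
        cong suc (halve a b (suc-injective (≡.trans (sym (+-suc a a)) (≡.trans (suc-injective e) (+-suc b b)))))
    shape : map length T ≡ n ∷ n ∷ []
    shape = cong₂ (λ x y → x ∷ y ∷ []) length₁ (≡.trans (sym (lengths t)) length₁)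
  from : ∀ T → T ∈ fillings [1… length μ ] (n ∷ n ∷ []) → IsSSYT (n ∷ n ∷ []) μ T → Tableau T
  from (r₁ ∷ r₂ ∷ []) i (shape , s₁ ∷ s₂ ∷ [] , col ∷ [-] , hc)
    with ∈-fillings⁻ (n ∷ n ∷ []) i
  ... | a₁ ∷ a₂ ∷ [] = (r₁ , r₂) , refl , tab (Linked⇒AllPairs ≤-trans s₁) (Linked⇒AllPairs ≤-trans s₂) col
    (≡.trans (proj₁ (∷-injective shape)) (sym (proj₁ (∷-injective (proj₂ (∷-injective shape))))))
    (λ v → ≡.trans (sym (occ-concat v r₁ r₂)) (Content.occ≡
      (hasContent⇒content μ _ (Allₚ.++⁺ a₁ (Allₚ.++⁺ a₂ [])) hc) v))

-- Arrays avoiding a pattern that begins with its least entry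

data Dir : Set where
  asc desc : Dir

Rel : Dir → ℕ → ℕ → Set
Rel asc  v w = v < w
Rel desc v w = w < v

rel-irrefl : ∀ d {v} → ¬ Rel d v v
rel-irrefl asc  = <-irrefl refl
rel-irrefl desc = <-irrefl refl

rel-trans : ∀ d {u v w} → Rel d u v → Rel d v w → Rel d u w
rel-trans asc  p q = <-trans p q
rel-trans desc p q = <-trans q p

rel-connex : ∀ d {v w} → ¬ Rel d v w → ¬ Rel d w v → v ≡ w
rel-connex asc  p q = ≤-antisym (≮⇒≥ q) (≮⇒≥ p)
rel-connex desc p q = ≤-antisym (≮⇒≥ p) (≮⇒≥ q)

rel? : ∀ d v w → Dec (Rel d v w)
rel? asc  v w = v <? w
rel? desc v w = w <? v

-- Decides which entry of a sorted row of two, both above m, is the extreme one: the larger for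
-- `asc`, the smaller for `desc`.
rel-≤ : ∀ d → (∀ u w → (w ≤ u → ¬ Rel d u w) × (¬ Rel d u w → w ≤ u))
             ⊎ (∀ u w → (u ≤ w → ¬ Rel d u w) × (¬ Rel d u w → u ≤ w))
rel-≤ asc  = inj₁ (λ u w → ≤⇒≯ , ≮⇒≥)
rel-≤ desc = inj₂ (λ u w → ≤⇒≯ , ≮⇒≥)

Pattern : Set₁
Pattern = ℕ → ℕ → ℕ → Set

-- The patterns beginning with their least entry: 123 for asc, 132 for desc.
Min : Dir → Pattern
Min d a b c = a < b × a < c × Rel d b c

-- An embedding for `Sublist _∈_` picks a, b, c from three different rows, in the order of the rows.
Free : Pattern → List (List ℕ) → Set
Free Q τ = ∀ a b c → Sublist _∈_ (a ∷ b ∷ c ∷ []) τ → ¬ Q a b c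

record Array (b : ℕ → ℕ) (α : List ℕ) (τ : List (List ℕ)) : Set where
  constructor array
  field
    shape  : map length τ ≡ α
    sorted : All (Linked _≤_) τ
    filled : Content b (concat τ)

open Array

array-cong : ∀ {b b′ α τ} → (∀ v → b v ≡ b′ v) → Array b α τ → Array b′ α τ
array-cong e (array sh so fi) = array sh so (content-cong e fi)

-- Arrays that stay pattern-free when preceded by the value m, the least value of the rows already removed.
Good : Dir → (ℕ → ℕ) → ℕ → List ℕ → List (List ℕ) → Set
Good d b m α τ = Array b α τ × Free (Min d) ((m ∷ []) ∷ τ)

-- Excludes the patterns with m first, the second entry in the row r, and the third in a later row,
-- whose values are those of `b`.
Local : Dir → ℕ → (ℕ → ℕ) → List ℕ → Set
Local d m b r = ∀ c w → c ∈ r → 1 ≤ b w → m < c → m < w → ¬ Rel d c w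

sublist₁ : ∀ {w : ℕ} τ → w ∈ concat τ → Sublist _∈_ (w ∷ []) τ
sublist₁ (r ∷ τ) i with ∈-++⁻ r i
... | inj₁ j = j ∷ minimum τ
... | inj₂ j = r ∷ʳ sublist₁ τ j

sublist₁⁻ : ∀ {w : ℕ} {τ} → Sublist _∈_ (w ∷ []) τ → w ∈ concat τ
sublist₁⁻ (r ∷ʳ s) = ∈-++⁺ʳ r (sublist₁⁻ s)
sublist₁⁻ (i ∷ s)  = ∈-++⁺ˡ i

module _ {d : Dir} {m m′ : ℕ} {r : List ℕ} {τ : List (List ℕ)} (m′≤m : m′ ≤ m) (m′≤r : All (m′ ≤_) r) where

  free-tail : m′ ≡ m ⊎ m′ ∈ r → Free (Min d) ((m ∷ []) ∷ r ∷ τ) → Free (Min d) ((m′ ∷ []) ∷ τ)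
  free-tail o free a b c (_ ∷ʳ s) q = free a b c (_ ∷ʳ (_ ∷ʳ s)) q
  free-tail (inj₁ refl) free a b c (here refl ∷ s) q = free a b c (here refl ∷ (_ ∷ʳ s)) q
  free-tail (inj₂ i) free a b c (here refl ∷ s) q = free a b c (_ ∷ʳ (i ∷ s)) q

  -- A pattern that starts in m or in r and continues in later rows may start in m′ instead, which
  -- is no greater. The one other kind, m first and the second entry in r, is excluded by `loc`.
  free-∷ : ∀ {b} → Content b (concat τ) → Local d m b r → Free (Min d) ((m′ ∷ []) ∷ τ) →
           Free (Min d) ((m ∷ []) ∷ r ∷ τ)
  free-∷ cnt loc free a b c (_ ∷ʳ (_ ∷ʳ s)) q = free a b c (_ ∷ʳ s) q
  free-∷ cnt loc free a b c (_ ∷ʳ (i ∷ s)) (a<b , a<c , bc) =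
    free m′ b c (here refl ∷ s) (≤-<-trans (All.lookup m′≤r i) a<b , ≤-<-trans (All.lookup m′≤r i) a<c , bc)
  free-∷ cnt loc free a b c (here refl ∷ (_ ∷ʳ s)) (a<b , a<c , bc) =
    free m′ b c (here refl ∷ s) (≤-<-trans m′≤m a<b , ≤-<-trans m′≤m a<c , bc)
  free-∷ cnt loc free a b c (here refl ∷ (i ∷ s)) (a<b , a<c , bc) =
    loc _ _ i (content-∈ cnt (sublist₁⁻ s)) a<b a<c bc

free-local : ∀ {d m r τ b} → Content b (concat τ) → Free (Min d) ((m ∷ []) ∷ r ∷ τ) → Local d m b r
free-local {m = m} {τ = τ} cnt free c w i le m<c m<w q =
  free _ _ _ (here refl ∷ (i ∷ sublist₁ τ (content-∋ cnt le))) (m<c , m<w , q)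

content-swap : ∀ {b x y xs} → Content b (x ∷ y ∷ xs) → Content b (y ∷ x ∷ xs)
content-swap {b} {x} {y} {xs} c = content (λ v → ≡.trans (swap v) (Content.occ≡ c v))
  where
  swap : ∀ v → occ v (y ∷ x ∷ xs) ≡ occ v (x ∷ y ∷ xs)
  swap v = begin
    occ v (y ∷ x ∷ xs)                               ≡⟨ occ-++ v [ y ] (x ∷ xs) ⟩
    occ v [ y ] + occ v (x ∷ xs)                     ≡⟨ cong (occ v [ y ] +_) (occ-++ v [ x ] xs) ⟩
    occ v [ y ] + (occ v [ x ] + occ v xs)           ≡⟨ rot (occ v [ y ]) (occ v [ x ]) (occ v xs) ⟩
    occ v [ x ] + (occ v [ y ] + occ v xs)           ≡⟨ cong (occ v [ x ] +_) (sym (occ-++ v [ y ] xs)) ⟩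
    occ v [ x ] + occ v (y ∷ xs)                     ≡⟨ sym (occ-++ v [ x ] (y ∷ xs)) ⟩
    occ v (x ∷ y ∷ xs)                               ∎
    where
    open ≡-Reasoning
    rot : ∀ a b c → a + (b + c) ≡ b + (a + c)
    rot = solve-∀

-- The extreme value above a bound

record Ext (d : Dir) (b : ℕ → ℕ) (m v : ℕ) : Set where
  constructor ext
  field
    above   : m < v
    present : 1 ≤ b v
    extreme : ∀ {w} → 1 ≤ b w → m < w → ¬ Rel d v w

open Ext

ext-unique : ∀ {d b m v w} → Ext d b m v → Ext d b m w → v ≡ w
ext-unique {d} e f = rel-connex d (extreme e (present f) (above f)) (extreme f (present e) (above e))

dec-pos : ∀ v {w} b → v ≢ w → 1 ≤ b w → 1 ≤ dec v b w
dec-pos v b v≢w le = ≤-trans le (≤-reflexive (sym (dec-≢ b v≢w)))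

dec-pos⁻ : ∀ v {w} b → 1 ≤ dec v b w → 1 ≤ b w
dec-pos⁻ v {w} b le = ≤-trans le (dec-≤ v b w)

ext-intro : ∀ {d b m v} → m < v → 1 ≤ b v → (∀ {w} → 1 ≤ dec v b w → m < w → ¬ Rel d v w) → Ext d b m v
ext-intro {d} {b} {m} {v} m<v le f = ext m<v le g
  where
  g : ∀ {w} → 1 ≤ b w → m < w → ¬ Rel d v w
  g {w} le m<w with v ≟ w
  ... | yesᵈ refl = rel-irrefl d
  ... | noᵈ v≢w   = f (dec-pos v b v≢w le) m<w

dec-swap : ∀ {b x y} → 1 ≤ b y → 1 ≤ dec y b x → 1 ≤ b x × 1 ≤ dec x b y
dec-swap {b} {x} {y} ly lx with x ≟ y
... | yesᵈ refl = ly , lx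
... | noᵈ x≢y   = dec-pos⁻ y b lx , dec-pos x b x≢y ly

module _ {d : Dir} {b : ℕ → ℕ} {m u v : ℕ} where

  -- Splits the condition on a row with two entries above m into two successive removals: u extreme
  -- among all values above m, v among those that u leaves. The comparison of u with v itself is
  -- supplied by the sortedness of the row.
  ext-pair⁺ : 1 ≤ b u → 1 ≤ dec u b v → m < u → m < v → ¬ Rel d u v →
              (∀ w → 1 ≤ dec v (dec u b) w → m < w → ¬ Rel d u w) →
              (∀ w → 1 ≤ dec v (dec u b) w → m < w → ¬ Rel d v w) → Ext d b m u × Ext d (dec u b) m v
  ext-pair⁺ lu lv m<u m<v ¬uv extu extv =
    ext-intro m<u lu (λ {w} → other w) , ext-intro m<v lv (λ {w} → extv w)
    where
    other : ∀ w → 1 ≤ dec u b w → m < w → ¬ Rel d u w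
    other w lw m<w with v ≟ w
    ... | yesᵈ refl = ¬uv
    ... | noᵈ v≢w   = extu w (dec-pos v (dec u b) v≢w lw) m<w

  ext-pair⁻ : Ext d b m u → Ext d (dec u b) m v → ¬ Rel d u v ×
              (∀ w → 1 ≤ dec v (dec u b) w → m < w → ¬ Rel d u w) ×
              (∀ w → 1 ≤ dec v (dec u b) w → m < w → ¬ Rel d v w)
  ext-pair⁻ x y = extreme x (dec-pos⁻ u b (present y)) (above y) ,
    (λ w lw → extreme x (dec-pos⁻ u b (dec-pos⁻ v (dec u b) lw))) ,
    (λ w lw → extreme y (dec-pos⁻ v (dec u b) lw))

ExtUpTo : Dir → (ℕ → ℕ) → ℕ → ℕ → ℕ → Set
ExtUpTo d b m j v = v ≤ j × m < v × 1 ≤ b v × (∀ w → w ≤ j → 1 ≤ b w → m < w → ¬ Rel d v w)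

ext-search : ∀ d b m j → ∃ (ExtUpTo d b m j) ⊎ (∀ w → w ≤ j → m < w → b w ≡ 0)
ext-search d b m zero = inj₂ (λ { _ z≤n () })
ext-search d b m (suc j) = extend (ext-search d b m j) ((m <? suc j) ×-dec (1 ≤? b (suc j)))
  where
  extremal : ∀ v → (m < suc j → 1 ≤ b (suc j) → ¬ Rel d v (suc j)) →
             (∀ w → w ≤ j → 1 ≤ b w → m < w → ¬ Rel d v w) →
             ∀ w → w ≤ suc j → 1 ≤ b w → m < w → ¬ Rel d v w
  extremal v new old w w≤ lw m<w with w ≟ suc j
  ... | yesᵈ refl = new m<w lw
  ... | noᵈ w≢    = old w (m<1+n⇒m≤n (≤∧≢⇒< w≤ w≢)) lw m<w
  extend : ∃ (ExtUpTo d b m j) ⊎ (∀ w → w ≤ j → m < w → b w ≡ 0) → Dec (m < suc j × 1 ≤ b (suc j)) →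
           ∃ (ExtUpTo d b m (suc j)) ⊎ (∀ w → w ≤ suc j → m < w → b w ≡ 0)
  extend (inj₁ (v , v≤j , m<v , le , f)) (yesᵈ (m<j , lj)) with rel? d v (suc j)
  ... | yesᵈ r = inj₁ (suc j , ≤-refl , m<j , lj ,
    extremal (suc j) (λ _ _ → rel-irrefl d) (λ w w≤ lw m<w s → f w w≤ lw m<w (rel-trans d r s)))
  ... | noᵈ ¬r = inj₁ (v , m≤n⇒m≤1+n v≤j , m<v , le , extremal v (λ _ _ → ¬r) f)
  extend (inj₁ (v , v≤j , m<v , le , f)) (noᵈ ¬new) =
    inj₁ (v , m≤n⇒m≤1+n v≤j , m<v , le , extremal v (λ m<j lj → ⊥-elim (¬new (m<j , lj))) f)
  extend (inj₂ none) (yesᵈ (m<j , lj)) = inj₁ (suc j , ≤-refl , m<j , lj ,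
    extremal (suc j) (λ _ _ → rel-irrefl d) (λ w w≤ lw m<w → ⊥-elim (n≮0 (subst (1 ≤_) (none w w≤ m<w) lw))))
  extend (inj₂ none) (noᵈ ¬new) = inj₂ none′
    where
    none′ : ∀ w → w ≤ suc j → m < w → b w ≡ 0
    none′ w w≤ m<w with w ≟ suc j
    ... | yesᵈ refl = n<1⇒n≡0 (≰⇒> (λ lj → ¬new (m<w , lj)))
    ... | noᵈ w≢    = none w (m<1+n⇒m≤n (≤∧≢⇒< w≤ w≢)) m<w

sum-caps-flat : ∀ b {m} j → m ≤ j → (∀ w → w ≤ j → m < w → b w ≡ 0) → sum (caps b j) ≡ sum (caps b m)
sum-caps-flat b {m} j m≤j z with m ≟ j
... | yesᵈ refl = refl
sum-caps-flat b {zero} zero m≤j z | noᵈ m≢j = refl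
sum-caps-flat b {m} (suc j) m≤j z | noᵈ m≢j =
  ≡.trans (cong (_+ sum (caps b j)) (z (suc j) ≤-refl (≤∧≢⇒< m≤j m≢j)))
    (sum-caps-flat b j (m<1+n⇒m≤n (≤∧≢⇒< m≤j m≢j)) (λ w w≤j → z w (m≤n⇒m≤1+n w≤j)))

sum-caps-mono : ∀ b {m} j → m ≤ j → sum (caps b m) ≤ sum (caps b j)
sum-caps-mono b {m} j m≤j with m ≟ j
... | yesᵈ refl = ≤-refl
sum-caps-mono b {zero} zero m≤j | noᵈ m≢j = ≤-refl
sum-caps-mono b {m} (suc j) m≤j | noᵈ m≢j =
  ≤-trans (sum-caps-mono b j (m<1+n⇒m≤n (≤∧≢⇒< m≤j m≢j))) (m≤n+m _ (b (suc j)))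

module _ {q : ℕ} {b : ℕ → ℕ} {m : ℕ} (sup : Supported q b) (m≤q : m ≤ q) where

  -- The equation says that `suc h` copies lie above m, so the search cannot come back empty.
  ext-exists : ∀ d {h} → sum (caps b q) ≡ sum (caps b m) + suc h → ∃ (Ext d b m)
  ext-exists d {h} e with ext-search d b m q
  ... | inj₁ (v , _ , m<v , le , f) = v , ext m<v le (λ {w} lw → f w (proj₂ (sup w lw)) lw)
  ... | inj₂ none = ⊥-elim (m≢1+m+n (sum (caps b m))
    (≡.trans (sym (sum-caps-flat b q m≤q none)) (≡.trans e (+-suc (sum (caps b m)) h))))

  pool-empty : ∀ {v} → sum (caps b q) ≡ sum (caps b m) + 0 → 1 ≤ b v → ¬ m < v
  pool-empty {v} e le m<v = <-irrefl refl (begin-strict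
    sum (caps b m)             ≡⟨ cong sum (sym (caps-dec-above b m m<v)) ⟩
    sum (caps (dec v b) m)     ≤⟨ sum-caps-mono (dec v b) q m≤q ⟩
    sum (caps (dec v b) q)     <⟨ n<1+n _ ⟩
    suc (sum (caps (dec v b) q)) ≡⟨ sym (sum-caps-dec b q (proj₁ (sup v le)) (proj₂ (sup v le)) le) ⟩
    sum (caps b q)             ≡⟨ ≡.trans e (+-identityʳ _) ⟩
    sum (caps b m)             ∎)
    where open ≤-Reasoning

caps-dec-top : ∀ {b} j {c} → b (suc j) ≡ suc c → caps (dec (suc j) b) (suc j) ≡ c ∷ caps b j
caps-dec-top {b} j e = cong₂ _∷_ (≡.trans (dec-≡ (suc j) b) (cong pred e)) (caps-dec-above {suc j} b j (n<1+n j))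

-- Removal of the first row

-- Together the two equations say that h copies lie above m and that there are as many places as
-- copies.
GoodCount : ℕ → Dir → List ℕ → Set
GoodCount q d α = ∀ b m h → Supported q b → m ≤ q → sum α ≡ sum (caps b m) + h → sum α ≡ sum (caps b q) →
             Card (Good d b m α) (W (caps b m ++ α) h)

module FirstRow {q : ℕ} (d : Dir) (X : List ℕ) where

  Row₁ Row₂ : Set
  Row₁ = ℕ × List (List ℕ)
  Row₂ = ℕ × Row₁

  -- The bound j is separate from the least value used, because it runs down from m while the
  -- columns are scanned.
  Below₁ : (ℕ → ℕ) → ℕ → Row₁ → Set
  Below₁ b j (x , τ) = 1 ≤ b x × x ≤ j × Good d (dec x b) x X τ

  Above₁ : (ℕ → ℕ) → ℕ → Row₁ → Set
  Above₁ b m (x , τ) = Ext d b m x × Good d (dec x b) m X τ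

  -- The summands V_{h+2}, V_h, V_{h-2} of V_h ⊗ V_2, by the number of entries above m. The larger
  -- entry `y` stands first, since the scan down the columns meets it first.
  Below₂ Mixed₂ Above₂ : (ℕ → ℕ) → ℕ → Row₂ → Set
  Below₂ b j (y , x , τ) = 1 ≤ b y × y ≤ j × x ≤ y × Below₁ (dec y b) j (x , τ)
  Mixed₂ b m (y , x , τ) = Ext d b m y × Below₁ (dec y b) m (x , τ)
  Above₂ b m (y , x , τ) = x ≤ y × m < x × 1 ≤ b y × 1 ≤ dec y b x ×
    Local d m (dec x (dec y b)) (x ∷ y ∷ []) × Good d (dec x (dec y b)) m X τ

  good₁⁺ : ∀ {b m x τ} → Below₁ b m (x , τ) ⊎ Above₁ b m (x , τ) → Good d b m (1 ∷ X) ((x ∷ []) ∷ τ)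
  good₁⁺ (inj₁ (le , x≤m , array sh so fi , free)) =
    array (cong (1 ∷_) sh) ([-] ∷ so) (content-∷ le fi) ,
    free-∷ x≤m (≤-refl ∷ []) fi (λ { _ _ (here refl) _ m<x _ _ → <⇒≱ m<x x≤m }) free
  good₁⁺ {b} {x = x} (inj₂ (e , array sh so fi , free)) =
    array (cong (1 ∷_) sh) ([-] ∷ so) (content-∷ (present e) fi) ,
    free-∷ ≤-refl (<⇒≤ (above e) ∷ []) fi (λ { _ _ (here refl) lw _ m<w → extreme e (dec-pos⁻ x b lw) m<w }) free

  good₁⁻ : ∀ {b m τ} → Good d b m (1 ∷ X) τ →
           ∃ λ (r : Row₁) → τ ≡ (proj₁ r ∷ []) ∷ proj₂ r × (Below₁ b m r ⊎ Above₁ b m r)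
  good₁⁻ {τ = []} (array () _ _ , _)
  good₁⁻ {τ = [] ∷ τ} (array () _ _ , _)
  good₁⁻ {τ = (_ ∷ _ ∷ _) ∷ τ} (array () _ _ , _)
  good₁⁻ {b} {m} {(x ∷ []) ∷ τ} (array sh (_ ∷ so) fi , free) = (x , τ) , refl , split (x ≤? m)
    where
    le = content-∈ fi (here refl)
    rest : Array (dec x b) X τ
    rest = array (∷-injectiveʳ sh) so (content-tail fi)
    split : Dec (x ≤ m) → Below₁ b m (x , τ) ⊎ Above₁ b m (x , τ)
    split (yesᵈ x≤m) = inj₁ (le , x≤m , rest , free-tail x≤m (≤-refl ∷ []) (inj₂ (here refl)) free)
    split (noᵈ x≰m)  = inj₂ (ext-intro (≰⇒> x≰m) le (λ lw → free-local (filled rest) free _ _ (here refl) lw (≰⇒> x≰m)) ,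
      rest , free-tail ≤-refl (<⇒≤ (≰⇒> x≰m) ∷ []) (inj₁ refl) free)

  good₂⁺ : ∀ {b m} (r : Row₂) → Below₂ b m r ⊎ Mixed₂ b m r ⊎ Above₂ b m r →
           Good d b m (2 ∷ X) ((proj₁ (proj₂ r) ∷ proj₁ r ∷ []) ∷ proj₂ (proj₂ r))
  good₂⁺ (y , x , τ) (inj₁ (ly , y≤m , x≤y , lx , x≤m , array sh so fi , free)) =
    array (cong (2 ∷_) sh) ((x≤y ∷ [-]) ∷ so) (content-swap (content-∷ ly (content-∷ lx fi))) ,
    free-∷ x≤m (≤-refl ∷ x≤y ∷ []) fi
      (λ { _ _ (here refl) _ m<x _ _ → <⇒≱ m<x x≤m ; _ _ (there (here refl)) _ m<y _ _ → <⇒≱ m<y y≤m }) free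
  good₂⁺ {b} (y , x , τ) (inj₂ (inj₁ (e , lx , x≤m , array sh so fi , free))) =
    array (cong (2 ∷_) sh) ((x≤y ∷ [-]) ∷ so) (content-swap (content-∷ (present e) (content-∷ lx fi))) ,
    free-∷ x≤m (≤-refl ∷ x≤y ∷ []) fi
      (λ { _ _ (here refl) _ m<x _ _ → <⇒≱ m<x x≤m
         ; _ _ (there (here refl)) lw _ m<w → extreme e (dec-pos⁻ y b (dec-pos⁻ x (dec y b) lw)) m<w }) free
    where
    x≤y : x ≤ y
    x≤y = ≤-trans x≤m (<⇒≤ (above e))
  good₂⁺ (y , x , τ) (inj₂ (inj₂ (x≤y , m<x , ly , lx , loc , array sh so fi , free))) =
    array (cong (2 ∷_) sh) ((x≤y ∷ [-]) ∷ so) (content-swap (content-∷ ly (content-∷ lx fi))) ,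
    free-∷ ≤-refl (<⇒≤ m<x ∷ <⇒≤ (<-≤-trans m<x x≤y) ∷ []) fi loc free

  good₂⁻ : ∀ {b m τ} → Good d b m (2 ∷ X) τ →
           ∃ λ (r : Row₂) → τ ≡ (proj₁ (proj₂ r) ∷ proj₁ r ∷ []) ∷ proj₂ (proj₂ r) ×
                            (Below₂ b m r ⊎ Mixed₂ b m r ⊎ Above₂ b m r)
  good₂⁻ {τ = []} (array () _ _ , _)
  good₂⁻ {τ = [] ∷ τ} (array () _ _ , _)
  good₂⁻ {τ = (_ ∷ []) ∷ τ} (array () _ _ , _)
  good₂⁻ {τ = (_ ∷ _ ∷ _ ∷ _) ∷ τ} (array () _ _ , _)
  good₂⁻ {b} {m} {(x ∷ y ∷ []) ∷ τ} (array sh ((x≤y ∷ _) ∷ so) fi , free) = (y , x , τ) , refl , split (x ≤? m) (y ≤? m)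
    where
    fi′ = content-tail (content-swap fi)
    ly = content-∈ fi (there (here refl))
    lx = content-∈ fi′ (here refl)
    rest : Array (dec x (dec y b)) X τ
    rest = array (∷-injectiveʳ sh) so (content-tail fi′)
    below : x ≤ m → Below₁ (dec y b) m (x , τ)
    below x≤m = lx , x≤m , rest , free-tail x≤m (≤-refl ∷ x≤y ∷ []) (inj₂ (here refl)) free
    loc : Local d m (dec x (dec y b)) (x ∷ y ∷ [])
    loc = free-local (filled rest) free
    split : Dec (x ≤ m) → Dec (y ≤ m) → _
    split (yesᵈ x≤m) (yesᵈ y≤m) = inj₁ (ly , y≤m , x≤y , below x≤m)
    split (yesᵈ x≤m) (noᵈ y≰m)  = inj₂ (inj₁ (ext-intro (≰⇒> y≰m) ly
      (λ lw m<w → loc _ _ (there (here refl)) (dec-pos x (dec y b) (λ { refl → <⇒≱ m<w x≤m }) lw) (≰⇒> y≰m) m<w) , below x≤m))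
    split (noᵈ x≰m)  _          = inj₂ (inj₂ (x≤y , ≰⇒> x≰m , ly , lx , loc , rest ,
      free-tail ≤-refl (<⇒≤ (≰⇒> x≰m) ∷ <⇒≤ (<-≤-trans (≰⇒> x≰m) x≤y) ∷ []) (inj₁ refl) free))

  total-dec : ∀ {b v s} → Supported q b → 1 ≤ b v → suc s ≡ sum (caps b q) → s ≡ sum (caps (dec v b) q)
  total-dec {b} {v} sup le t = suc-injective (≡.trans t (sum-caps-dec b q (proj₁ (sup v le)) (proj₂ (sup v le)) le))

  module Step (IH : GoodCount q d X) where

    -- Scan the columns downwards from j. Passing over a column adds its copies to the h values
    -- above the bound; taking an entry from it leaves h alone and one copy fewer in it. For a
    -- column of height c+1 these are the two terms of `U (suc c) f (suc h)`.
    card-below₁ : ∀ b j h → Supported q b → j ≤ q → suc (sum X) ≡ sum (caps b j) + h →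
                  suc (sum X) ≡ sum (caps b q) → Card (Below₁ b j) (W (caps b j ++ X) (suc h))
    -- No column is left, and the multiplicity vanishes because `suc h` exceeds the total of X.
    card-below₁ b zero h sup j≤q e t = card-size (sym (W-vanish X (suc h) (m≤n⇒m≤1+n (≤-reflexive e))))
      (card-empty (λ { (x , _) (le , x≤0 , _) → <⇒≱ (proj₁ (sup x le)) x≤0 }))
    card-below₁ b (suc j) h sup j<q e t = step (b (suc j)) refl
      where
      f : ℕ → ℕ
      f = W (caps b j ++ X)
      lower : ∀ {x} → x ≤ suc j → x ≢ suc j → x ≤ j
      lower x≤ x≢ = m<1+n⇒m≤n (≤∧≢⇒< x≤ x≢)
      step : ∀ c → b (suc j) ≡ c → Card (Below₁ b (suc j)) (U c f (suc h))
      step zero c≡ = card-⇔ (λ { _ (le , x≤j , g) → le , m≤n⇒m≤1+n x≤j , g })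
        (λ { _ (le , x≤j , g) → le , lower x≤j (λ { refl → n≮0 (subst (1 ≤_) c≡ le) }) , g })
        (card-below₁ b j h sup (<⇒≤ j<q) (≡.trans e (cong (λ c → c + sum (caps b j) + h) c≡)) t)
      step (suc c) c≡ = card-⊎ {P = Below₁ b j} {Q = Top} split
        (λ { _ (le , x≤j , g) → le , m≤n⇒m≤1+n x≤j , g }) (λ { _ (refl , g) → top , ≤-refl , g })
        (λ { _ (_ , x≤j , _) (refl , _) → <⇒≱ (n<1+n j) x≤j })
        (card-below₁ b j (h + suc c) sup (<⇒≤ j<q) (≡.trans e′ (rot (suc c) (sum (caps b j)) h)) t)
        (card-bij (suc j ,_) proj₂ (λ _ g → refl , g) (λ { _ (refl , g) → g }) (λ _ _ → refl) (λ { _ (refl , g) → refl })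
          (card-size (cong (λ γ → W (γ ++ X) h) γ≡)
            (IH (dec (suc j) b) (suc j) h (supported-dec {b = b} (suc j) sup) j<q
              (≡.trans (suc-injective e′) (cong (λ γ → sum γ + h) (sym γ≡))) (total-dec {b} sup top t))))
        where
        top : 1 ≤ b (suc j)
        top = subst (1 ≤_) (sym c≡) (s≤s z≤n)
        e′ : suc (sum X) ≡ suc c + sum (caps b j) + h
        e′ = ≡.trans e (cong (λ c → c + sum (caps b j) + h) c≡)
        rot : ∀ c s h → c + s + h ≡ s + (h + c)
        rot = solve-∀
        γ≡ : caps (dec (suc j) b) (suc j) ≡ c ∷ caps b j
        γ≡ = caps-dec-top {b} j c≡
        Top : Row₁ → Set
        Top (x , τ) = x ≡ suc j × Good d (dec (suc j) b) (suc j) X τ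
        split : ∀ r → Below₁ b (suc j) r → Below₁ b j r ⊎ Top r
        split (x , τ) (le , x≤j , g) with x ≟ suc j
        ... | yesᵈ refl = inj₂ (refl , g)
        ... | noᵈ x≢    = inj₁ (le , lower x≤j x≢ , g)

    -- The same scan, for the larger entry. Once it is taken from a column, the smaller one is
    -- scanned for from that same column on, so the condition x ≤ y is the bound of the second scan.
    card-below₂ : ∀ b j h → Supported q b → j ≤ q → 2 + sum X ≡ sum (caps b j) + h →
                  2 + sum X ≡ sum (caps b q) → Card (Below₂ b j) (W (caps b j ++ X) (2 + h))
    card-below₂ b zero h sup j≤q e t =
      card-size (sym (W-vanish X (2 + h) (m≤n⇒m≤1+n (≤-trans (n≤1+n _) (≤-trans (≤-reflexive e) (n≤1+n h))))))
      (card-empty (λ { (y , _) (le , y≤0 , _) → <⇒≱ (proj₁ (sup y le)) y≤0 }))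
    card-below₂ b (suc j) h sup j<q e t = step (b (suc j)) refl
      where
      f : ℕ → ℕ
      f = W (caps b j ++ X)
      lower : ∀ {x} → x ≤ suc j → x ≢ suc j → x ≤ j
      lower x≤ x≢ = m<1+n⇒m≤n (≤∧≢⇒< x≤ x≢)
      widen : ∀ r → Below₂ b j r → Below₂ b (suc j) r
      widen _ (ly , y≤j , x≤y , lx , x≤j , g) = ly , m≤n⇒m≤1+n y≤j , x≤y , lx , m≤n⇒m≤1+n x≤j , g
      narrow : ∀ {y x τ} → y ≢ suc j → Below₂ b (suc j) (y , x , τ) → Below₂ b j (y , x , τ)
      narrow y≢ (ly , y≤j , x≤y , lx , x≤j , g) = ly , lower y≤j y≢ , x≤y , lx , ≤-trans x≤y (lower y≤j y≢) , g
      step : ∀ c → b (suc j) ≡ c → Card (Below₂ b (suc j)) (U c f (2 + h))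
      step zero c≡ = card-⇔ widen
        (λ { _ r@(ly , _) → narrow (λ { refl → n≮0 (subst (1 ≤_) c≡ ly) }) r })
        (card-below₂ b j h sup (<⇒≤ j<q) (≡.trans e (cong (λ c → c + sum (caps b j) + h) c≡)) t)
      step (suc c) c≡ = card-⊎ {P = Below₂ b j} {Q = Top} split widen
        (λ { _ (refl , r@(_ , x≤j , _)) → top , ≤-refl , x≤j , r })
        (λ { _ (_ , y≤j , _) (refl , _) → <⇒≱ (n<1+n j) y≤j })
        (card-below₂ b j (h + suc c) sup (<⇒≤ j<q) (≡.trans e′ (rot (suc c) (sum (caps b j)) h)) t)
        (card-bij (suc j ,_) proj₂ (λ _ g → refl , g) (λ { _ (refl , g) → g }) (λ _ _ → refl) (λ { _ (refl , g) → refl })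
          (card-size (cong (λ γ → W (γ ++ X) (suc h)) γ≡)
            (card-below₁ (dec (suc j) b) (suc j) h (supported-dec {b = b} (suc j) sup) j<q
              (≡.trans (suc-injective e′) (cong (λ γ → sum γ + h) (sym γ≡))) (total-dec {b} sup top t))))
        where
        top : 1 ≤ b (suc j)
        top = subst (1 ≤_) (sym c≡) (s≤s z≤n)
        e′ : 2 + sum X ≡ suc c + sum (caps b j) + h
        e′ = ≡.trans e (cong (λ c → c + sum (caps b j) + h) c≡)
        rot : ∀ c s h → c + s + h ≡ s + (h + c)
        rot = solve-∀
        γ≡ : caps (dec (suc j) b) (suc j) ≡ c ∷ caps b j
        γ≡ = caps-dec-top {b} j c≡
        Top : Row₂ → Set
        Top (y , r) = y ≡ suc j × Below₁ (dec (suc j) b) (suc j) r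
        split : ∀ r → Below₂ b (suc j) r → Below₂ b j r ⊎ Top r
        split (y , x , τ) r@(_ , _ , _ , r₁) with y ≟ suc j
        ... | yesᵈ refl = inj₂ (refl , r₁)
        ... | noᵈ y≢    = inj₁ (narrow y≢ r)

    module Pool (b : ℕ → ℕ) (m : ℕ) (sup : Supported q b) (m≤q : m ≤ q) where

      f : ℕ → ℕ
      f = W (caps b m ++ X)

      pool-dec : ∀ {v s h} → m < v → suc s ≡ sum (caps b m) + suc h → s ≡ sum (caps (dec v b) m) + h
      pool-dec {v} {s} {h} m<v e = ≡.trans (suc-injective (≡.trans e (+-suc (sum (caps b m)) h)))
        (cong (λ γ → sum γ + h) (sym (caps-dec-above b m m<v)))

      W-dec : ∀ {v} → m < v → ∀ h → W (caps (dec v b) m ++ X) h ≡ f h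
      W-dec m<v h = cong (λ γ → W (γ ++ X) h) (caps-dec-above b m m<v)

      -- The entry is forced and the least value stays m, so only the number of values above m
      -- changes, from `suc h` to h.
      card-above₁ : ∀ h → suc (sum X) ≡ sum (caps b m) + suc h → suc (sum X) ≡ sum (caps b q) →
                    Card (Above₁ b m) (f h)
      card-above₁ h e t with ext-exists sup m≤q d (≡.trans (sym t) e)
      ... | v , x = card-bij (v ,_) proj₂ (λ _ g → x , g)
        (λ { (w , τ) (y , g) → subst (λ w → Good d (dec w b) m X τ) (ext-unique y x) g }) (λ _ _ → refl)
        (λ { (w , τ) (y , g) → cong (_, τ) (ext-unique x y) })
        (card-size (W-dec (above x) h)
          (IH (dec v b) m h (supported-dec {b = b} v sup) m≤q (pool-dec (above x) e) (total-dec {b} sup (present x) t)))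

      card-mixed₂ : ∀ h → 2 + sum X ≡ sum (caps b m) + suc h → 2 + sum X ≡ sum (caps b q) →
                    Card (Mixed₂ b m) (f (suc h))
      card-mixed₂ h e t with ext-exists sup m≤q d (≡.trans (sym t) e)
      ... | v , x = card-bij (v ,_) proj₂ (λ _ g → x , g)
        (λ { (w , r) (y , g) → subst (λ w → Below₁ (dec w b) m r) (ext-unique y x) g }) (λ _ _ → refl)
        (λ { (w , r) (y , g) → cong (_, r) (ext-unique x y) })
        (card-size (W-dec (above x) (suc h))
          (card-below₁ (dec v b) m h (supported-dec {b = b} v sup) m≤q (pool-dec (above x) e) (total-dec {b} sup (present x) t)))

    module _ (b : ℕ → ℕ) (m : ℕ) (sup : Supported q b) (m≤q : m ≤ q) where

      open Pool b m sup m≤q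

      Extremes : ℕ → ℕ → List (List ℕ) → Set
      Extremes u v τ = Ext d b m u × Above₁ (dec u b) m (v , τ)

      -- A row lists its entries by size, the removal by extremality. For `asc` the larger entry
      -- goes first, for `desc` the smaller, and the order of the two removals does not affect what
      -- is left.
      Extremes⇔Above₂ : ((∀ y x τ → Extremes y x τ → Above₂ b m (y , x , τ)) × (∀ y x τ → Above₂ b m (y , x , τ) → Extremes y x τ))
                      ⊎ ((∀ y x τ → Extremes x y τ → Above₂ b m (y , x , τ)) × (∀ y x τ → Above₂ b m (y , x , τ) → Extremes x y τ))
      Extremes⇔Above₂ with rel-≤ d
      ... | inj₁ rel = inj₁ (to , from)
        where
        to : ∀ y x τ → Extremes y x τ → Above₂ b m (y , x , τ)
        to y x τ (ey , ex , g) with ext-pair⁻ ey ex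
        ... | ¬r , locy , locx = proj₂ (rel y x) ¬r , above ex , present ey , present ex ,
          (λ { _ w (here refl) lw _ → locx w lw ; _ w (there (here refl)) lw _ → locy w lw }) , g
        from : ∀ y x τ → Above₂ b m (y , x , τ) → Extremes y x τ
        from y x τ (x≤y , m<x , ly , lx , loc , g) =
          let m<y = <-≤-trans m<x x≤y
              ey , ex = ext-pair⁺ ly lx m<y m<x (proj₁ (rel y x) x≤y)
                          (λ w lw → loc y w (there (here refl)) lw m<y) (λ w lw → loc x w (here refl) lw m<x)
          in ey , ex , g
      ... | inj₂ rel = inj₂ (to , from)
        where
        to : ∀ y x τ → Extremes x y τ → Above₂ b m (y , x , τ)
        to y x τ (ex , ey , (arr , free)) with ext-pair⁻ ex ey | dec-swap {b} {y} {x} (present ex) (present ey)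
        ... | ¬r , locx , locy | ly , lx = proj₂ (rel x y) ¬r , above ex , ly , lx ,
          (λ { _ w (here refl) lw _ → locx w (comm lw) ; _ w (there (here refl)) lw _ → locy w (comm lw) }) ,
          (array-cong (dec-comm y x b) arr , free)
          where
          comm : ∀ {w} → 1 ≤ dec x (dec y b) w → 1 ≤ dec y (dec x b) w
          comm {w} = subst (1 ≤_) (dec-comm x y b w)
        from : ∀ y x τ → Above₂ b m (y , x , τ) → Extremes x y τ
        from y x τ (x≤y , m<x , ly , lx , loc , (arr , free)) =
          let m<y = <-≤-trans m<x x≤y
              lx′ , ly′ = dec-swap {b} ly lx
              ex , ey = ext-pair⁺ lx′ ly′ m<x m<y (proj₁ (rel x y) x≤y)
                          (λ w lw → loc x w (here refl) (comm lw) m<x) (λ w lw → loc y w (there (here refl)) (comm lw) m<y)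
          in ex , ey , (array-cong (dec-comm x y b) arr , free)
          where
          comm : ∀ {w} → 1 ≤ dec y (dec x b) w → 1 ≤ dec x (dec y b) w
          comm {w} = subst (1 ≤_) (dec-comm y x b w)

      card-extremes : ∀ h → 2 + sum X ≡ sum (caps b m) + (2 + h) → 2 + sum X ≡ sum (caps b q) →
                      Card (λ { (u , v , τ) → Extremes u v τ }) (f h)
      card-extremes h e t with ext-exists sup m≤q d (≡.trans (sym t) e)
      ... | v , x = card-bij (v ,_) proj₂ (λ _ g → x , g)
        (λ { (w , r) (y , g) → subst (λ w → Above₁ (dec w b) m r) (ext-unique y x) g }) (λ _ _ → refl)
        (λ { (w , r) (y , g) → cong (_, r) (ext-unique x y) })
        (card-size (W-dec (above x) h) (Pool.card-above₁ (dec v b) m (supported-dec {b = b} v sup) m≤q h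
          (pool-dec (above x) e) (total-dec {b} sup (present x) t)))

      card-above₂ : ∀ h → 2 + sum X ≡ sum (caps b m) + (2 + h) → 2 + sum X ≡ sum (caps b q) →
                    Card (Above₂ b m) (f h)
      card-above₂ h e t with Extremes⇔Above₂
      ... | inj₁ (to , from) = card-⇔ (λ { (y , x , τ) → to y x τ }) (λ { (y , x , τ) → from y x τ }) (card-extremes h e t)
      ... | inj₂ (to , from) = card-bij (λ { (x , y , τ) → y , x , τ }) (λ { (y , x , τ) → x , y , τ })
        (λ { (x , y , τ) → to y x τ }) (λ { (y , x , τ) → from y x τ }) (λ _ _ → refl) (λ _ _ → refl) (card-extremes h e t)

      card-good₁ : ∀ h → suc (sum X) ≡ sum (caps b m) + h → suc (sum X) ≡ sum (caps b q) →
                   Card (Good d b m (1 ∷ X)) (U 1 f h)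
      card-good₁ h e t = card-bij {P = λ r → Below₁ b m r ⊎ Above₁ b m r} (λ { (x , τ) → (x ∷ []) ∷ τ }) uncons
        (λ { (x , τ) → good₁⁺ }) (λ { τ g → from τ (good₁⁻ g) }) (λ _ _ → refl) (λ { τ g → inv τ (good₁⁻ g) }) (rows h e)
        where
        uncons : List (List ℕ) → Row₁
        uncons ((x ∷ _) ∷ τ) = x , τ
        uncons _             = 0 , []
        from : ∀ τ → (∃ λ (r : Row₁) → τ ≡ (proj₁ r ∷ []) ∷ proj₂ r × (Below₁ b m r ⊎ Above₁ b m r)) →
               Below₁ b m (uncons τ) ⊎ Above₁ b m (uncons τ)
        from _ (_ , refl , x) = x
        inv : ∀ τ → (∃ λ (r : Row₁) → τ ≡ (proj₁ r ∷ []) ∷ proj₂ r × (Below₁ b m r ⊎ Above₁ b m r)) →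
              (proj₁ (uncons τ) ∷ []) ∷ proj₂ (uncons τ) ≡ τ
        inv _ (_ , refl , _) = refl
        rows : ∀ h → suc (sum X) ≡ sum (caps b m) + h → Card (λ r → Below₁ b m r ⊎ Above₁ b m r) (U 1 f h)
        -- With no value above m only the scan remains, as V_0 ⊗ V_1 = V_1 has a single summand.
        rows zero e = card-⇔ (λ _ → inj₁)
          (λ { _ (inj₁ r) → r ; _ (inj₂ (x , _)) → ⊥-elim (pool-empty sup m≤q (≡.trans (sym t) e) (present x) (above x)) })
          (card-below₁ b m 0 sup m≤q e t)
        rows (suc h) e = card-size (sym (U₁-suc f h))
          (card-⊎ (λ _ r → r) (λ _ → inj₁) (λ _ → inj₂) (λ { _ (_ , x≤m , _) (x , _) → <⇒≱ (above x) x≤m })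
            (card-below₁ b m (suc h) sup m≤q e t) (card-above₁ h e t))

      card-good₂ : ∀ h → 2 + sum X ≡ sum (caps b m) + h → 2 + sum X ≡ sum (caps b q) →
                   Card (Good d b m (2 ∷ X)) (U 2 f h)
      card-good₂ h e t = card-bij {P = Any₂} (λ { (y , x , τ) → (x ∷ y ∷ []) ∷ τ }) uncons
        (λ { (y , x , τ) → good₂⁺ (y , x , τ) }) (λ { τ g → from τ (good₂⁻ g) }) (λ _ _ → refl)
        (λ { τ g → inv τ (good₂⁻ g) }) (rows h e)
        where
        Any₂ : Row₂ → Set
        Any₂ r = Below₂ b m r ⊎ Mixed₂ b m r ⊎ Above₂ b m r
        uncons : List (List ℕ) → Row₂
        uncons ((x ∷ y ∷ _) ∷ τ) = y , x , τ
        uncons _                 = 0 , 0 , []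
        Split : List (List ℕ) → Set
        Split τ = ∃ λ (r : Row₂) → τ ≡ (proj₁ (proj₂ r) ∷ proj₁ r ∷ []) ∷ proj₂ (proj₂ r) × Any₂ r
        from : ∀ τ → Split τ → Any₂ (uncons τ)
        from _ (_ , refl , x) = x
        inv : ∀ τ → Split τ →
              (proj₁ (proj₂ (uncons τ)) ∷ proj₁ (uncons τ) ∷ []) ∷ proj₂ (proj₂ (uncons τ)) ≡ τ
        inv _ (_ , refl , _) = refl
        above₂-empty : 2 + sum X ≡ sum (caps b m) + 1 → ∀ r → ¬ Above₂ b m r
        above₂-empty e (y , x , τ) (x≤y , m<x , ly , lx , _) =
          pool-empty (supported-dec {b = b} y sup) m≤q
            (≡.trans (sym (total-dec {b} sup ly t)) (pool-dec (<-≤-trans m<x x≤y) e)) lx m<x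
        mixed-or-above : ∀ r → Mixed₂ b m r → ¬ Above₂ b m r
        mixed-or-above _ (_ , _ , x≤m , _) (_ , m<x , _) = <⇒≱ m<x x≤m
        below-or-not : ∀ r → Below₂ b m r → ¬ (Mixed₂ b m r ⊎ Above₂ b m r)
        below-or-not _ (_ , y≤m , _) (inj₁ (y , _)) = <⇒≱ (above y) y≤m
        below-or-not _ (_ , y≤m , _) (inj₂ (x≤y , m<x , _)) = <⇒≱ (<-≤-trans m<x x≤y) y≤m
        rows : ∀ h → 2 + sum X ≡ sum (caps b m) + h → Card Any₂ (U 2 f h)
        rows zero e = card-⇔ (λ _ → inj₁)
          (λ { _ (inj₁ r) → r
             ; _ (inj₂ (inj₁ (y , _))) → ⊥-elim (pool-empty sup m≤q (≡.trans (sym t) e) (present y) (above y))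
             ; _ (inj₂ (inj₂ (x≤y , m<x , ly , _))) → ⊥-elim (pool-empty sup m≤q (≡.trans (sym t) e) ly (<-≤-trans m<x x≤y)) })
          (card-below₂ b m 0 sup m≤q e t)
        -- With a single value above m two entries cannot both lie there, matching V_1 ⊗ V_2 = V_3 ⊕
        -- V_1.
        rows (suc zero) e = card-⊎ {Q = Mixed₂ b m}
          (λ { _ (inj₁ r) → inj₁ r ; _ (inj₂ (inj₁ r)) → inj₂ r ; r (inj₂ (inj₂ x)) → ⊥-elim (above₂-empty e r x) })
          (λ _ → inj₁) (λ _ → inj₂ ∘ inj₁) (λ r p q → below-or-not r p (inj₁ q))
          (card-below₂ b m 1 sup m≤q e t) (card-mixed₂ 0 e t)
        rows (suc (suc h)) e = card-size (sym (U₂-suc² f h))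
          (card-⊎ (λ _ r → r) (λ _ → inj₁) (λ _ → inj₂) below-or-not
            (card-below₂ b m (2 + h) sup m≤q e t)
            (card-⊎ (λ _ r → r) (λ _ → inj₁) (λ _ → inj₂) mixed-or-above
              (card-mixed₂ (suc h) e t) (card-above₂ h e t)))

W-zeros : ∀ γ → sum γ ≡ 0 → W (γ ++ []) 0 ≡ 1
W-zeros []         e = refl
W-zeros (zero ∷ γ) e = W-zeros γ e

-- The factor of the first row stands behind the columns in `W`; commuting it to the front exposes
-- the recurrence found by removing that row.
card-Good : ∀ {q d α} → All OneOrTwo α → GoodCount q d α
card-Good {q} {d} [] b m h sup m≤q e t with m+n≡0⇒m≡0 (sum (caps b m)) (sym e) | m+n≡0⇒n≡0 (sum (caps b m)) (sym e)
... | γ≡0 | refl = card-size (sym (W-zeros (caps b m) γ≡0))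
  (card-singleton [] (array refl [] (content (λ v → sym (b≡0 v))) , (λ { _ _ _ (here refl ∷ ()) ; _ _ _ (_ ∷ʳ ()) }))
    (λ { [] _ → refl ; (_ ∷ _) (array () _ _ , _) }))
  where
  b≡0 : ∀ v → b v ≡ 0
  b≡0 v with 1 ≤? b v
  ... | noᵈ b<1 = n<1⇒n≡0 (≰⇒> b<1)
  ... | yesᵈ le = ⊥-elim (0≢1+n (≡.trans t (sum-caps-dec b q (proj₁ (sup v le)) (proj₂ (sup v le)) le)))
card-Good {q} {d} {_ ∷ X} (inj₁ refl ∷ os) b m h sup m≤q e t = card-size (sym (W-pull (inj₁ refl) (caps b m) X h))
  (FirstRow.Step.card-good₁ d X (card-Good os) b m sup m≤q h e t)
card-Good {q} {d} {_ ∷ X} (inj₂ refl ∷ os) b m h sup m≤q e t = card-size (sym (W-pull (inj₂ refl) (caps b m) X h))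
  (FirstRow.Step.card-good₂ d X (card-Good os) b m sup m≤q h e t)

FreeArray : Pattern → (ℕ → ℕ) → List ℕ → List (List ℕ) → Set
FreeArray Q b α τ = Array b α τ × Free Q τ

sublist-All : ∀ {P : ℕ → Set} {as τ} → All (All P) τ → Sublist _∈_ as τ → All P as
sublist-All []       []       = []
sublist-All (p ∷ ps) (_ ∷ʳ s) = sublist-All ps s
sublist-All (p ∷ ps) (i ∷ s)  = All.lookup p i ∷ sublist-All ps s

all-rows : ∀ {P : ℕ → Set} τ → All P (concat τ) → All (All P) τ
all-rows []      ps = []
all-rows (r ∷ τ) ps = Allₚ.++⁻ˡ r ps ∷ all-rows τ (Allₚ.++⁻ʳ r ps)

array-bounded : ∀ {q b α τ} → Supported q b → Array b α τ → All (All (_≤ q)) τ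
array-bounded {τ = τ} sup arr =
  all-rows τ (All.tabulate (λ i → proj₂ (sup _ (content-∈ (Array.filled arr) i))))

-- A fictitious row holding q may be put in front: no value exceeds q, so it begins no pattern, and
-- nothing lies above it, so h = 0.
card-Min : ∀ {q b α} d → All OneOrTwo α → Supported q b → sum α ≡ sum (caps b q) →
           Card (FreeArray (Min d) b α) (W (caps b q ++ α) 0)
card-Min {q} {b} {α} d os sup t = card-⇔ to from
  (card-Good {q} {d} os b q 0 sup ≤-refl (≡.trans t (sym (+-identityʳ _))) t)
  where
  to : ∀ τ → Good d b q α τ → FreeArray (Min d) b α τ
  to τ (arr , free) = arr , λ u v w s → free u v w (_ ∷ʳ s)
  from : ∀ τ → FreeArray (Min d) b α τ → Good d b q α τ
  from τ (arr , free) = arr , free′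
    where
    free′ : Free (Min d) ((q ∷ []) ∷ τ)
    free′ u v w (_ ∷ʳ s) = free u v w s
    free′ u v w (here refl ∷ s) (q<v , _) with sublist-All (array-bounded sup arr) s
    ... | v≤q ∷ _ = <⇒≱ q<v v≤q

-- Symmetries: complementing values and reversing rows

all-reverse : ∀ {A : Set} {P : A → Set} {xs : List A} → All P xs → All P (reverse xs)
all-reverse ps = All.tabulate (λ i → All.lookup ps (Anyₚ.reverse⁻ i))

-- Complementation turns an increasing row into a decreasing one; the reversal sorts it again and
-- leaves its members, hence the patterns, alone.
flipRow : ℕ → List ℕ → List ℕ
flipRow N r = reverse (map (N ∸_) r)

flip : ℕ → List (List ℕ) → List (List ℕ)
flip N = map (flipRow N)

occ-reverse : ∀ v xs → occ v (reverse xs) ≡ occ v xs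
occ-reverse v []       = refl
occ-reverse v (x ∷ xs) = begin
  occ v (reverse (x ∷ xs))            ≡⟨ cong (occ v) (unfold-reverse x xs) ⟩
  occ v (reverse xs ++ [ x ])         ≡⟨ occ-++ v (reverse xs) [ x ] ⟩
  occ v (reverse xs) + occ v [ x ]    ≡⟨ cong (_+ occ v [ x ]) (occ-reverse v xs) ⟩
  occ v xs + occ v [ x ]              ≡⟨ +-comm (occ v xs) _ ⟩
  occ v [ x ] + occ v xs              ≡⟨ sym (occ-++ v [ x ] xs) ⟩
  occ v (x ∷ xs)                      ∎
  where open ≡-Reasoning

occ-map-∸ : ∀ {N v} xs → v ≤ N → All (_≤ N) xs → occ v (map (N ∸_) xs) ≡ occ (N ∸ v) xs
occ-map-∸ [] v≤N [] = refl
occ-map-∸ {N} {v} (x ∷ xs) v≤N (x≤N ∷ a) with x ≟ N ∸ v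
... | yesᵈ refl rewrite m∸[m∸n]≡n v≤N =
  ≡.trans (occ-∷≡ v _) (≡.trans (cong suc (occ-map-∸ xs v≤N a)) (sym (occ-∷≡ (N ∸ v) xs)))
... | noᵈ x≢ = ≡.trans (occ-∷≢ {v} {N ∸ x} (map (N ∸_) xs) (λ e → x≢ (≡.trans (sym (m∸[m∸n]≡n x≤N)) (cong (N ∸_) e))))
  (≡.trans (occ-map-∸ xs v≤N a) (sym (occ-∷≢ xs x≢)))

occ-flip : ∀ {N v} τ → v ≤ N → All (All (_≤ N)) τ → occ v (concat (flip N τ)) ≡ occ (N ∸ v) (concat τ)
occ-flip [] v≤N [] = refl
occ-flip {N} {v} (r ∷ τ) v≤N (a ∷ as) = begin
  occ v (flipRow N r ++ concat (flip N τ))             ≡⟨ occ-++ v (flipRow N r) _ ⟩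
  occ v (flipRow N r) + occ v (concat (flip N τ))
    ≡⟨ cong₂ _+_ (≡.trans (occ-reverse v (map (N ∸_) r)) (occ-map-∸ r v≤N a)) (occ-flip τ v≤N as) ⟩
  occ (N ∸ v) r + occ (N ∸ v) (concat τ)               ≡⟨ sym (occ-++ (N ∸ v) r (concat τ)) ⟩
  occ (N ∸ v) (r ++ concat τ)                          ∎
  where open ≡-Reasoning

∈-flipRow : ∀ {N v r} → All (_≤ N) r → v ∈ flipRow N r → v ≤ N × (N ∸ v) ∈ r
∈-flipRow {N} {v} {r} a i with ∈-map⁻ (N ∸_) {xs = r} (Anyₚ.reverse⁻ i)
... | x , j , refl = m∸n≤m N x , subst (_∈ r) (sym (m∸[m∸n]≡n (All.lookup a j))) j

flip-bounded : ∀ {N τ} → All (All (_≤ N)) τ → All (All (_≤ N)) (flip N τ)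
flip-bounded []       = []
flip-bounded (a ∷ as) = All.tabulate (λ i → proj₁ (∈-flipRow a i)) ∷ flip-bounded as

sublist-flip : ∀ {N as τ} → All (All (_≤ N)) τ → Sublist _∈_ as (flip N τ) → Sublist _∈_ (map (N ∸_) as) τ
sublist-flip {τ = []}    []       []       = []
sublist-flip {τ = r ∷ τ} (a ∷ bs) (_ ∷ʳ s) = r ∷ʳ sublist-flip bs s
sublist-flip {τ = r ∷ τ} (a ∷ bs) (i ∷ s)  = proj₂ (∈-flipRow a i) ∷ sublist-flip bs s

flipRow-involutive : ∀ {N r} → All (_≤ N) r → flipRow N (flipRow N r) ≡ r
flipRow-involutive {N} {r} a = begin
  reverse (map (N ∸_) (reverse (map (N ∸_) r)))   ≡⟨ cong reverse (reverse-map (N ∸_) (map (N ∸_) r)) ⟩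
  reverse (reverse (map (N ∸_) (map (N ∸_) r)))   ≡⟨ reverse-involutive _ ⟩
  map (N ∸_) (map (N ∸_) r)                       ≡⟨ twice a ⟩
  r                                               ∎
  where
  open ≡-Reasoning
  twice : ∀ {r} → All (_≤ N) r → map (N ∸_) (map (N ∸_) r) ≡ r
  twice []       = refl
  twice (p ∷ ps) = cong₂ _∷_ (m∸[m∸n]≡n p) (twice ps)

flip-involutive : ∀ {N τ} → All (All (_≤ N)) τ → flip N (flip N τ) ≡ τ
flip-involutive []       = refl
flip-involutive (a ∷ as) = cong₂ _∷_ (flipRow-involutive a) (flip-involutive as)

flip-sorted : ∀ {N α τ} → All OneOrTwo α → map length τ ≡ α → All (Linked _≤_) τ → All (Linked _≤_) (flip N τ)
flip-sorted {τ = []} os refl [] = []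
flip-sorted {τ = [] ∷ τ} (inj₁ () ∷ _) refl _
flip-sorted {τ = [] ∷ τ} (inj₂ () ∷ _) refl _
flip-sorted {τ = (x ∷ []) ∷ τ} (_ ∷ os) refl (_ ∷ ls) = [-] ∷ flip-sorted os refl ls
flip-sorted {N} {τ = (x ∷ y ∷ []) ∷ τ} (_ ∷ os) refl ((x≤y ∷ _) ∷ ls) = (∸-monoʳ-≤ N x≤y ∷ [-]) ∷ flip-sorted os refl ls
flip-sorted {τ = (_ ∷ _ ∷ _ ∷ _) ∷ τ} (inj₁ () ∷ _) refl _
flip-sorted {τ = (_ ∷ _ ∷ _ ∷ _) ∷ τ} (inj₂ () ∷ _) refl _

unsupported : ∀ {q b} v → Supported q b → ¬ (1 ≤ v × v ≤ q) → b v ≡ 0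
unsupported {b = b} v sup out with b v in e
... | zero  = refl
... | suc _ = ⊥-elim (out (sup v (subst (1 ≤_) (sym e) (s≤s z≤n))))

module _ {q : ℕ} {b : ℕ → ℕ} (sup : Supported q b) where

  private
    N : ℕ
    N = suc q

  flipped-supported : Supported q (λ v → b (N ∸ v))
  flipped-supported zero le = ⊥-elim (<⇒≱ (n<1+n q) (proj₂ (sup N le)))
  flipped-supported (suc v) le = s≤s z≤n , m∸n≢0⇒n<m (λ e → n≮0 (≤-trans (proj₁ (sup (q ∸ v) le)) (≤-reflexive e)))

  flipped-twice : ∀ v → b (N ∸ (N ∸ v)) ≡ b v
  flipped-twice v with v ≤? N
  ... | yesᵈ v≤N = cong b (m∸[m∸n]≡n v≤N)
  -- Truncated subtraction leads such a v to `b N`, which is 0 like `b v`: both labels lie outside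
  -- 1, ..., q.
  ... | noᵈ v≰N = ≡.trans (cong (λ x → b (N ∸ x)) (m≤n⇒m∸n≡0 (<⇒≤ (≰⇒> v≰N))))
    (≡.trans (unsupported N sup (λ p → <⇒≱ (n<1+n q) (proj₂ p)))
      (sym (unsupported v sup (λ p → v≰N (m≤n⇒m≤1+n (proj₂ p))))))

  flip-FreeArray : ∀ {P Q α τ} → All OneOrTwo α →
    (∀ {u v w} → u ≤ N → v ≤ N → w ≤ N → Q u v w → P (N ∸ u) (N ∸ v) (N ∸ w)) →
    FreeArray P b α τ → FreeArray Q (λ v → b (N ∸ v)) α (flip N τ)
  flip-FreeArray {P} {Q} {α} {τ} os Q⇒P (arr , free) =
    array shape′ (flip-sorted os (Array.shape arr) (Array.sorted arr)) (content filled′) , free′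
    where
    bounded : All (All (_≤ N)) τ
    bounded = All.map (All.map m≤n⇒m≤1+n) (array-bounded sup arr)
    shape′ : map length (flip N τ) ≡ α
    shape′ = ≡.trans (sym (map-∘ τ)) (≡.trans (map-cong (λ r → ≡.trans (length-reverse (map (N ∸_) r)) (length-map (N ∸_) r)) τ) (Array.shape arr))
    filled′ : ∀ v → occ v (concat (flip N τ)) ≡ b (N ∸ v)
    filled′ v with v ≤? N
    ... | yesᵈ v≤N = ≡.trans (occ-flip τ v≤N bounded) (Content.occ≡ (Array.filled arr) (N ∸ v))
    ... | noᵈ v≰N = ≡.trans absent (sym (unsupported (N ∸ v) sup (λ p → <⇒≱ (proj₁ p) (≤-reflexive (m≤n⇒m∸n≡0 (<⇒≤ (≰⇒> v≰N)))))))
      where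
      absent : occ v (concat (flip N τ)) ≡ 0
      absent with occ v (concat (flip N τ)) in e
      ... | zero  = refl
      ... | suc _ = ⊥-elim (v≰N (All.lookup (Allₚ.concat⁺ (flip-bounded bounded))
        (occ⇒∈ (concat (flip N τ)) (subst (1 ≤_) (sym e) (s≤s z≤n)))))
    free′ : Free Q (flip N τ)
    free′ u v w s x with sublist-All (flip-bounded bounded) s
    ... | u≤ ∷ v≤ ∷ w≤ ∷ [] = free _ _ _ (sublist-flip bounded s) (Q⇒P u≤ v≤ w≤ x)

-- The patterns beginning with their greatest entry: 321 for asc, 312 for desc.
Max : Dir → Pattern
Max d a b c = b < a × c < a × Rel d c b

∸-Rel : ∀ d {N u v} → u ≤ N → v ≤ N → Rel d u v → Rel d (N ∸ v) (N ∸ u)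
∸-Rel asc  u≤ v≤ r = ∸-monoʳ-< r v≤
∸-Rel desc u≤ v≤ r = ∸-monoʳ-< r u≤

-- Complementation exchanges 123 with 321 and 132 with 312, and reverses the list of columns.
card-Max : ∀ {q b α} d → All OneOrTwo α → Supported q b → sum α ≡ sum (caps b q) →
           Card (FreeArray (Max d) b α) (W (reverse (caps b q) ++ α) 0)
card-Max {q} {b} {α} d os sup t = card-size (cong (λ γ → W (γ ++ α) 0) (caps-flip b q))
  (card-bij (flip N) (flip N)
    (λ τ x → let arr , free = flip-FreeArray sup′ os Max⇒Min x in array-cong (flipped-twice sup) arr , free)
    (λ τ → flip-FreeArray sup os Min⇒Max)
    (λ τ x → flip-involutive (bounded sup′ (proj₁ x))) (λ τ x → flip-involutive (bounded sup (proj₁ x)))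
    (card-Min d os sup′ (≡.trans t (≡.trans (sym (sum-↭ (↭-reverse (caps b q)))) (cong sum (sym (caps-flip b q)))))))
  where
  N = suc q
  sup′ = flipped-supported {q} {b} sup
  bounded : ∀ {b τ} → Supported q b → Array b α τ → All (All (_≤ N)) τ
  bounded s arr = All.map (All.map m≤n⇒m≤1+n) (array-bounded s arr)
  Max⇒Min : ∀ {u v w} → u ≤ N → v ≤ N → w ≤ N → Max d u v w → Min d (N ∸ u) (N ∸ v) (N ∸ w)
  Max⇒Min u≤ v≤ w≤ (vu , wu , r) = ∸-monoʳ-< vu u≤ , ∸-monoʳ-< wu u≤ , ∸-Rel d w≤ v≤ r
  Min⇒Max : ∀ {u v w} → u ≤ N → v ≤ N → w ≤ N → Min d u v w → Max d (N ∸ u) (N ∸ v) (N ∸ w)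
  Min⇒Max u≤ v≤ w≤ (uv , uw , r) = ∸-monoʳ-< uv v≤ , ∸-monoʳ-< uw w≤ , ∸-Rel d v≤ w≤ r

occ-concat-reverse : ∀ v τ → occ v (concat (reverse τ)) ≡ occ v (concat τ)
occ-concat-reverse v []      = refl
occ-concat-reverse v (r ∷ τ) = begin
  occ v (concat (reverse (r ∷ τ)))              ≡⟨ cong (occ v ∘ concat) (unfold-reverse r τ) ⟩
  occ v (concat (reverse τ ++ [ r ]))           ≡⟨ cong (occ v) (sym (concat-++ (reverse τ) [ r ])) ⟩
  occ v (concat (reverse τ) ++ (r ++ []))       ≡⟨ occ-++ v (concat (reverse τ)) (r ++ []) ⟩
  occ v (concat (reverse τ)) + occ v (r ++ [])  ≡⟨ cong₂ _+_ (occ-concat-reverse v τ) (cong (occ v) (++-identityʳ r)) ⟩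
  occ v (concat τ) + occ v r                    ≡⟨ +-comm (occ v (concat τ)) (occ v r) ⟩
  occ v r + occ v (concat τ)                    ≡⟨ sym (occ-++ v r (concat τ)) ⟩
  occ v (r ++ concat τ)                         ∎
  where open ≡-Reasoning

Reversed : Pattern → Pattern
Reversed Q a b c = Q c b a

reverse-FreeArray : ∀ {Q b α τ} → FreeArray Q b α τ → FreeArray (Reversed Q) b (reverse α) (reverse τ)
reverse-FreeArray {Q} {b} {α} {τ} (array sh so fi , free) =
  array (≡.trans (reverse-map length τ) (cong reverse sh)) (all-reverse so)
    (content (λ v → ≡.trans (occ-concat-reverse v τ) (Content.occ≡ fi v))) ,
  λ u v w s → free w v u (subst (Sublist _∈_ (w ∷ v ∷ u ∷ [])) (reverse-involutive τ) (reverse⁺ s))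

-- All α are included because reversing the rows reverses α. The order of the factors drops out of
-- `W`, so one number can serve every pattern.
record WilfClass (Q : Pattern) : Set where
  field
    card : ∀ α β → All OneOrTwo α → All OneOrTwo β → sum α ≡ sum β →
           Card (FreeArray Q (cont 1 β) α) (W (α ++ β) 0)

open WilfClass

sum-cont : ∀ β → sum (caps (cont 1 β) (length β)) ≡ sum β
sum-cont β = ≡.trans (cong sum (caps-cont β)) (sum-↭ (↭-reverse β))

W-α++β : ∀ {α β γ} → All OneOrTwo α → All OneOrTwo β → γ ↭ β → W (γ ++ α) 0 ≡ W (α ++ β) 0
W-α++β {α} {β} {γ} os ps p = sym (W-↭ (Allₚ.++⁺ os ps) (↭-trans (++-comm α β) (++⁺ (↭-sym p) ↭-refl)) 0)

wilf-Min : ∀ d → WilfClass (Min d)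
wilf-Min d .card α β os ps e = card-size (W-α++β os ps (subst (_↭ β) (sym (caps-cont β)) (↭-reverse β)))
  (card-Min d os (cont-supported β) (≡.trans e (sym (sum-cont β))))

wilf-Max : ∀ d → WilfClass (Max d)
wilf-Max d .card α β os ps e = card-size
  (W-α++β os ps (↭-trans (↭-reverse (caps (cont 1 β) (length β))) (subst (_↭ β) (sym (caps-cont β)) (↭-reverse β))))
  (card-Max d os (cont-supported β) (≡.trans e (sym (sum-cont β))))

wilf-Reversed : ∀ {Q} → WilfClass Q → WilfClass (Reversed Q)
wilf-Reversed {Q} wQ .card α β os ps e = card-size
  (sym (W-↭ (Allₚ.++⁺ os ps) (++⁺ (↭-sym (↭-reverse α)) ↭-refl) 0))
  (card-bij reverse reverse
    (λ τ x → subst (λ a → FreeArray (Reversed Q) (cont 1 β) a (reverse τ)) (reverse-involutive α) (reverse-FreeArray x))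
    (λ τ → reverse-FreeArray) (λ τ _ → reverse-involutive τ) (λ τ _ → reverse-involutive τ)
    (card wQ (reverse α) β (all-reverse os) ps (≡.trans (sum-↭ (↭-reverse α)) e)))

wilf-⇔ : ∀ {P Q} → (∀ {a b c} → P a b c → Q a b c) → (∀ {a b c} → Q a b c → P a b c) → WilfClass P → WilfClass Q
wilf-⇔ to from wP .card α β os ps e =
  card-⇔ (λ { _ (arr , free) → arr , λ a b c s x → free a b c s (from x) })
    (λ { _ (arr , free) → arr , λ a b c s x → free a b c s (to x) }) (card wP α β os ps e)

-- The six patterns of length 3

-- Only one direction of the order equivalence is kept; for distinct p, q, r the other follows by
-- trichotomy, as in `reflects`.
OrderedAs : Fin 3 → Fin 3 → Fin 3 → Pattern
OrderedAs p q r a b c =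
  (p Fin.< q → a < b) × (q Fin.< p → b < a) × (p Fin.< r → a < c) ×
  (r Fin.< p → c < a) × (q Fin.< r → b < c) × (r Fin.< q → c < b)

pattern 0F = zero
pattern 1F = suc zero
pattern 2F = suc (suc zero)

wilf-OrderedAs : ∀ p q r → p ≢ q → p ≢ r → q ≢ r → WilfClass (OrderedAs p q r)
wilf-OrderedAs 0F 0F _  p≢q _ _ = ⊥-elim (p≢q refl)
wilf-OrderedAs 1F 1F _  p≢q _ _ = ⊥-elim (p≢q refl)
wilf-OrderedAs 2F 2F _  p≢q _ _ = ⊥-elim (p≢q refl)
wilf-OrderedAs 0F _  0F _ p≢r _ = ⊥-elim (p≢r refl)
wilf-OrderedAs 1F _  1F _ p≢r _ = ⊥-elim (p≢r refl)
wilf-OrderedAs 2F _  2F _ p≢r _ = ⊥-elim (p≢r refl)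
wilf-OrderedAs _  0F 0F _ _ q≢r = ⊥-elim (q≢r refl)
wilf-OrderedAs _  1F 1F _ _ q≢r = ⊥-elim (q≢r refl)
wilf-OrderedAs _  2F 2F _ _ q≢r = ⊥-elim (q≢r refl)
wilf-OrderedAs 0F 1F 2F _ _ _ = wilf-⇔
  (λ { (ab , ac , bc) → (λ _ → ab) , (λ ()) , (λ _ → ac) , (λ ()) , (λ _ → bc) , (λ { (s≤s ()) }) })
  (λ { (ab , _ , ac , _ , bc , _) → ab (s≤s z≤n) , ac (s≤s z≤n) , bc (s≤s (s≤s z≤n)) }) (wilf-Min asc)
wilf-OrderedAs 0F 2F 1F _ _ _ = wilf-⇔
  (λ { (ab , ac , cb) → (λ _ → ab) , (λ ()) , (λ _ → ac) , (λ ()) , (λ { (s≤s ()) }) , (λ _ → cb) })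
  (λ { (ab , _ , ac , _ , _ , cb) → ab (s≤s z≤n) , ac (s≤s z≤n) , cb (s≤s (s≤s z≤n)) }) (wilf-Min desc)
wilf-OrderedAs 2F 1F 0F _ _ _ = wilf-⇔
  (λ { (ba , ca , cb) → (λ { (s≤s ()) }) , (λ _ → ba) , (λ ()) , (λ _ → ca) , (λ ()) , (λ _ → cb) })
  (λ { (_ , ba , _ , ca , _ , cb) → ba (s≤s (s≤s z≤n)) , ca (s≤s z≤n) , cb (s≤s z≤n) }) (wilf-Max asc)
wilf-OrderedAs 2F 0F 1F _ _ _ = wilf-⇔
  (λ { (ba , ca , bc) → (λ ()) , (λ _ → ba) , (λ { (s≤s ()) }) , (λ _ → ca) , (λ _ → bc) , (λ ()) })
  (λ { (_ , ba , _ , ca , bc , _) → ba (s≤s z≤n) , ca (s≤s (s≤s z≤n)) , bc (s≤s z≤n) }) (wilf-Max desc)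
-- 231 is 132 read backwards, and 213 is 312 read backwards.
wilf-OrderedAs 1F 2F 0F _ _ _ = wilf-⇔
  (λ { (cb , ca , ab) → (λ _ → ab) , (λ { (s≤s ()) }) , (λ ()) , (λ _ → ca) , (λ ()) , (λ _ → cb) })
  (λ { (ab , _ , _ , ca , _ , cb) → cb (s≤s z≤n) , ca (s≤s z≤n) , ab (s≤s (s≤s z≤n)) }) (wilf-Reversed (wilf-Min desc))
wilf-OrderedAs 1F 0F 2F _ _ _ = wilf-⇔
  (λ { (bc , ac , ba) → (λ ()) , (λ _ → ba) , (λ _ → ac) , (λ { (s≤s ()) }) , (λ _ → bc) , (λ ()) })
  (λ { (_ , ba , ac , _ , bc , _) → bc (s≤s z≤n) , ac (s≤s (s≤s z≤n)) , ba (s≤s z≤n) }) (wilf-Reversed (wilf-Max desc))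

blocks₁ : ∀ {v} τ i → InBlock τ i v → Sublist _∈_ (v ∷ []) τ
blocks₁ (r ∷ τ) zero    x = x ∷ minimum τ
blocks₁ (r ∷ τ) (suc i) x = r ∷ʳ blocks₁ τ i x

blocks₂ : ∀ {v w} τ i j → i < j → InBlock τ i v → InBlock τ j w → Sublist _∈_ (v ∷ w ∷ []) τ
blocks₂ (r ∷ τ) zero    (suc j) _         x y = x ∷ blocks₁ τ j y
blocks₂ (r ∷ τ) (suc i) (suc j) (s≤s i<j) x y = r ∷ʳ blocks₂ τ i j i<j x y

blocks₃ : ∀ {u v w} τ i j k → i < j → j < k → InBlock τ i u → InBlock τ j v → InBlock τ k w →
          Sublist _∈_ (u ∷ v ∷ w ∷ []) τ
blocks₃ (r ∷ τ) zero    (suc j) (suc k) _         (s≤s j<k) x y z = x ∷ blocks₂ τ j k j<k y z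
blocks₃ (r ∷ τ) (suc i) (suc j) (suc k) (s≤s i<j) (s≤s j<k) x y z = r ∷ʳ blocks₃ τ i j k i<j j<k x y z

blocks₁⁻ : ∀ {v τ} → Sublist _∈_ (v ∷ []) τ → ∃ λ i → InBlock τ i v
blocks₁⁻ (_ ∷ʳ s) = let i , x = blocks₁⁻ s in suc i , x
blocks₁⁻ (x ∷ s)  = 0 , x

blocks₂⁻ : ∀ {v w τ} → Sublist _∈_ (v ∷ w ∷ []) τ → ∃ λ i → ∃ λ j → i < j × InBlock τ i v × InBlock τ j w
blocks₂⁻ (_ ∷ʳ s) = let i , j , i<j , x , y = blocks₂⁻ s in suc i , suc j , s≤s i<j , x , y
blocks₂⁻ (x ∷ s)  = let j , y = blocks₁⁻ s in 0 , suc j , s≤s z≤n , x , y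

blocks₃⁻ : ∀ {u v w τ} → Sublist _∈_ (u ∷ v ∷ w ∷ []) τ →
           ∃ λ i → ∃ λ j → ∃ λ k → i < j × j < k × InBlock τ i u × InBlock τ j v × InBlock τ k w
blocks₃⁻ (_ ∷ʳ s) =
  let i , j , k , i<j , j<k , x , y , z = blocks₃⁻ s in suc i , suc j , suc k , s≤s i<j , s≤s j<k , x , y , z
blocks₃⁻ (x ∷ s)  =
  let j , k , j<k , y , z = blocks₂⁻ s in 0 , suc j , suc k , s≤s z≤n , s≤s j<k , x , y , z

module _ (π : Permutation′ 3) where

  private
    π-injective : ∀ {s t} → π ⟨$⟩ʳ s ≡ π ⟨$⟩ʳ t → s ≡ t
    π-injective {s} {t} e = ≡.trans (sym (inverseˡ π)) (≡.trans (cong (π ⟨$⟩ˡ_) e) (inverseˡ π))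

  OrderedAsπ : Pattern
  OrderedAsπ = OrderedAs (π ⟨$⟩ʳ 0F) (π ⟨$⟩ʳ 1F) (π ⟨$⟩ʳ 2F)

  wilf-π : WilfClass OrderedAsπ
  wilf-π = wilf-OrderedAs _ _ _ ((λ ()) ∘ π-injective {0F} {1F}) ((λ ()) ∘ π-injective {0F} {2F})
    ((λ ()) ∘ π-injective {1F} {2F})

  free⇒avoids : ∀ {τ} → Free OrderedAsπ τ → Avoids π τ
  free⇒avoids {τ} free (i , v , i₀<i₁ , i₁<i₂ , inb , ord) =
    free (v 0F) (v 1F) (v 2F) (blocks₃ τ _ _ _ i₀<i₁ i₁<i₂ (inb 0F) (inb 1F) (inb 2F))
      (proj₂ (ord 0F 1F) , proj₂ (ord 1F 0F) , proj₂ (ord 0F 2F) , proj₂ (ord 2F 0F) , proj₂ (ord 1F 2F) , proj₂ (ord 2F 1F))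

  avoids⇒free : ∀ {τ} → Avoids π τ → Free OrderedAsπ τ
  avoids⇒free {τ} avoids a b c s (ab , ba , ac , ca , bc , cb) with blocks₃⁻ s
  ... | i , j , k , i<j , j<k , x , y , z = avoids (index , value , i<j , j<k , inb , λ s t → reflects s t , preserves s t)
    where
    index value : Fin 3 → ℕ
    index 0F = i
    index 1F = j
    index 2F = k
    value 0F = a
    value 1F = b
    value 2F = c
    inb : ∀ s → InBlock τ (index s) (value s)
    inb 0F = x
    inb 1F = y
    inb 2F = z
    preserves : ∀ s t → (π ⟨$⟩ʳ s) Fin.< (π ⟨$⟩ʳ t) → value s < value t
    preserves 0F 0F p = ⊥-elim (<-irrefl refl p)
    preserves 0F 1F p = ab p
    preserves 0F 2F p = ac p
    preserves 1F 0F p = ba p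
    preserves 1F 1F p = ⊥-elim (<-irrefl refl p)
    preserves 1F 2F p = bc p
    preserves 2F 0F p = ca p
    preserves 2F 1F p = cb p
    preserves 2F 2F p = ⊥-elim (<-irrefl refl p)
    reflects : ∀ s t → value s < value t → (π ⟨$⟩ʳ s) Fin.< (π ⟨$⟩ʳ t)
    reflects s t p with Finₚ.<-cmp (π ⟨$⟩ʳ s) (π ⟨$⟩ʳ t)
    ... | tri< lt _ _ = lt
    ... | tri≈ _ e _  = ⊥-elim (<-irrefl (cong value (π-injective e)) p)
    ... | tri> _ _ gt = ⊥-elim (<-asym p (preserves t s gt))

  count-S : ∀ α β → All OneOrTwo α → All OneOrTwo β → sum α ≡ sum β → SCount α β π (W (α ++ β) 0)
  count-S α β os ps e = card⇒count (Listₚ.≡-dec (Listₚ.≡-dec _≟_))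
    (unique-fillings (unique-[1…] (length β)) α) to from (card wilf-π α β os ps e)
    where
    to : ∀ τ → FreeArray OrderedAsπ (cont 1 β) α τ → τ ∈ fillings [1… length β ] α × (IsArray α β τ × Avoids π τ)
    to τ (array sh so fi , free) =
      subst (λ a → τ ∈ fillings [1… length β ] a) sh
        (∈-fillings⁺ (all-rows τ (content⇒inRange (cont-supported β) fi))) ,
      (sh , so , content⇒hasContent β fi) , free⇒avoids free
    from : ∀ τ → τ ∈ fillings [1… length β ] α → IsArray α β τ × Avoids π τ → FreeArray OrderedAsπ (cont 1 β) α τ
    from τ i ((sh , so , hc) , avoids) =
      array sh so (hasContent⇒content β _ (Allₚ.concat⁺ (∈-fillings⁻ α i)) hc) , avoids⇒free avoids

-- Iterated differences of the Catalan numbers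

open import Data.Integer as ℤ using (ℤ; +_; -[1+_])
import Data.Integer.Properties as ℤₚ
open import Data.List.Relation.Unary.Unique.DecPropositional ℤ._≟_ using (unique?)

-- Induction on j for all k at once: trading two factors V₁ for one V₂ expresses the value at (j+1,
-- k) as that at (j, k+1) minus that at (j, k), which is one application of `D` at the index k+j+1.
D^-catalan : ∀ j k → + W (comp12 (2 * k) j) 0 ≡ D^ j catalan (k + j)
D^-catalan zero k = cong +_ (begin
  W (comp12 (2 * k) 0) 0                     ≡⟨ sym (m*n/n≡m (W (comp12 (2 * k) 0) 0) (suc k)) ⟩
  W (comp12 (2 * k) 0) 0 * suc k / suc k     ≡⟨ cong (_/ suc k) (W-catalan k) ⟩
  ((2 * k) C k) / suc k                      ≡⟨ cong (λ x → ((2 * x) C x) / suc x) (sym (+-identityʳ k)) ⟩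
  ((2 * (k + 0)) C (k + 0)) / suc (k + 0)     ∎)
  where open ≡-Reasoning
D^-catalan (suc j) k rewrite +-suc k j = begin
  + w                              ≡⟨ sym (ℤₚ.+-identityʳ (+ w)) ⟩
  + w ℤ.+ + 0                      ≡⟨ cong (λ x → + w ℤ.+ x) (sym (ℤₚ.+-inverseʳ (+ v))) ⟩
  + w ℤ.+ (+ v ℤ.- + v)            ≡⟨ sym (ℤₚ.+-assoc (+ w) (+ v) (ℤ.- + v)) ⟩
  + (w + v) ℤ.- + v                ≡⟨ cong (λ x → + x ℤ.- + v) (sym (W-comp12-split (2 * k) j)) ⟩
  + W (comp12 (2 + 2 * k) j) 0 ℤ.- + v
    ≡⟨ cong (λ x → + W (comp12 x j) 0 ℤ.- + v) (sym (*-suc 2 k)) ⟩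
  + W (comp12 (2 * suc k) j) 0 ℤ.- + v
    ≡⟨ cong₂ ℤ._-_ (D^-catalan j (suc k)) (D^-catalan j k) ⟩
  D^ j catalan (suc (k + j)) ℤ.- D^ j catalan (k + j) ∎
  where
  open ≡-Reasoning
  w v : ℕ
  w = W (comp12 (2 * k) (suc j)) 0
  v = W (comp12 (2 * k) j) 0

-- Lattice paths

Starts : {A : Set} → A → (List A → Set) → List A → Set
Starts s P p = ∃ λ p′ → p ≡ s ∷ p′ × P p′

card-starts : {A : Set} (s : A) {P : List A → Set} {c : ℕ} → Card P c → Card (Starts s P) c
card-starts s = card-bij (s ∷_) (drop 1) (λ p Pp → p , refl , Pp) (λ { _ (_ , refl , Pp) → Pp })
  (λ _ _ → refl) (λ { _ (_ , refl , _) → refl })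

card-starts₂ : {A : Set} {s t : A} {P Q R : List A → Set} {c d : ℕ} → s ≢ t →
  (∀ p → R p → Starts s P p ⊎ Starts t Q p) →
  (∀ p → P p → R (s ∷ p)) → (∀ p → Q p → R (t ∷ p)) → Card P c → Card Q d → Card R (c + d)
card-starts₂ s≢t split inl inr C D =
  card-⊎ split (λ { _ (p , refl , x) → inl p x }) (λ { _ (p , refl , x) → inr p x })
    (λ { _ (_ , refl , _) (_ , refl , _) → s≢t refl }) (card-starts _ C) (card-starts _ D)

card-starts₃ : {A : Set} {s t u : A} {P Q O R : List A → Set} {c d e : ℕ} → s ≢ t → s ≢ u → t ≢ u →
  (∀ p → R p → Starts s P p ⊎ Starts t Q p ⊎ Starts u O p) →
  (∀ p → P p → R (s ∷ p)) → (∀ p → Q p → R (t ∷ p)) → (∀ p → O p → R (u ∷ p)) →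
  Card P c → Card Q d → Card O e → Card R (c + (d + e))
card-starts₃ s≢t s≢u t≢u split in₁ in₂ in₃ C D E =
  card-⊎ split (λ { _ (p , refl , x) → in₁ p x })
    (λ { _ (inj₁ (p , refl , x)) → in₂ p x ; _ (inj₂ (p , refl , x)) → in₃ p x })
    (λ { _ (_ , refl , _) (inj₁ (_ , refl , _)) → s≢t refl
       ; _ (_ , refl , _) (inj₂ (_ , refl , _)) → s≢u refl })
    (card-starts _ C)
    (card-⊎ (λ _ x → x) (λ _ → inj₁) (λ _ → inj₂)
      (λ { _ (_ , refl , _) (_ , refl , _) → t≢u refl }) (card-starts _ D) (card-starts _ E))

-- F = ⊤ forbids flat steps on the axis, F = ⊥ allows them.
Path : Set → List (List ℤ) → ℕ → List ℤ → Set
Path F Ss h p =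
  Pointwise (λ S s → s ∈ S) Ss p × (F → NoFlatOnAxis (+ h) p) ×
  NeverBelow (+ h) p × + h ℤ.+ sumℤ p ≡ + 0

module _ {F : Set} {S : List ℤ} {Ss : List (List ℤ)} where

  path-tail : ∀ {h h′ s p} → + h ℤ.+ s ≡ + h′ → Path F (S ∷ Ss) h (s ∷ p) → Path F Ss h′ p
  path-tail {h} {h′} {s} {p} e (_ ∷ pw , nf , (_ , nb) , end) =
    pw , (λ x → subst (λ y → NoFlatOnAxis y p) e (proj₂ (nf x))) ,
    subst (λ y → NeverBelow y p) e nb ,
    ≡.trans (cong (λ y → y ℤ.+ sumℤ p) (sym e)) (≡.trans (ℤₚ.+-assoc (+ h) s (sumℤ p)) end)

  path-∷ : ∀ {h h′ s p} → s ∈ S → (F → ¬ (+ h ≡ + 0 × s ≡ + 0)) → + h ℤ.+ s ≡ + h′ →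
           Path F Ss h′ p → Path F (S ∷ Ss) h (s ∷ p)
  path-∷ {h} {h′} {s} {p} i ok e (pw , nf , nb , end) =
    i ∷ pw , (λ x → ok x , subst (λ y → NoFlatOnAxis y p) (sym e) (nf x)) ,
    (subst (+ 0 ℤ.≤_) (sym e) (ℤ.+≤+ z≤n) , subst (λ y → NeverBelow y p) (sym e) nb) ,
    ≡.trans (sym (ℤₚ.+-assoc (+ h) s (sumℤ p))) (≡.trans (cong (λ y → y ℤ.+ sumℤ p) e) end)

path-[]₀ : ∀ {F} → Card (Path F [] 0) 1
path-[]₀ = card-singleton [] ([] , (λ _ → tt) , tt , refl) (λ { _ ([] , _) → refl })

path-[]₊ : ∀ {F h} → Card (Path F [] (suc h)) 0
path-[]₊ = card-empty (λ { _ ([] , _ , _ , ()) })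

±1 ±2,0 ±1,0 : List ℤ
±1   = + 1 ∷ -[1+ 0 ] ∷ []
±2,0 = + 2 ∷ + 0 ∷ -[1+ 1 ] ∷ []
±1,0 = + 1 ∷ + 0 ∷ -[1+ 0 ] ∷ []

steps : ℕ → List ℤ
steps 1 = ±1
steps _ = ±2,0

flat : ∀ h → + h ℤ.+ + 0 ≡ + h
flat h = cong +_ (+-identityʳ h)

-- The steps allowed at height h lead to the constituents of V_h ⊗ V_c. Those forbidden, below the
-- axis or level on it, are exactly the terms that the Clebsch-Gordan rule omits when h < c.
card-CR : ∀ {cs} → All OneOrTwo cs → ∀ h → Card (Path ⊤ (map steps cs) h) (W cs h)
card-CR [] zero    = path-[]₀
card-CR [] (suc h) = path-[]₊
card-CR (inj₁ refl ∷ os) zero = card-⇔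
  (λ { _ (_ , refl , x) → path-∷ (here refl) (λ { _ (_ , ()) }) refl x })
  (λ { (_ ∷ p) x@(here refl ∷ _ , _) → p , refl , path-tail refl x
     ; (_ ∷ p) (there (here refl) ∷ _ , _ , (() , _) , _) })
  (card-starts (+ 1) (card-CR os 1))
card-CR (inj₁ refl ∷ os) (suc h) = card-starts₂ {s = + 1} { -[1+ 0 ]} (λ ())
  (λ { (_ ∷ p) x@(here refl ∷ _ , _) → inj₁ (p , refl , path-tail refl x)
     ; (_ ∷ p) x@(there (here refl) ∷ _ , _) → inj₂ (p , refl , path-tail refl x) })
  (λ _ → path-∷ (here refl) (λ { _ (() , _) }) refl)
  (λ _ → path-∷ (there (here refl)) (λ { _ (() , _) }) refl)
  (card-CR os (suc h + 1)) (card-CR os h)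
card-CR (inj₂ refl ∷ os) zero = card-⇔
  (λ { _ (_ , refl , x) → path-∷ (here refl) (λ { _ (_ , ()) }) refl x })
  (λ { (_ ∷ p) x@(here refl ∷ _ , _) → p , refl , path-tail refl x
     ; (_ ∷ p) (there (here refl) ∷ _ , nf , _) → ⊥-elim (proj₁ (nf tt) (refl , refl))
     ; (_ ∷ p) (there (there (here refl)) ∷ _ , _ , (() , _) , _) })
  (card-starts (+ 2) (card-CR os 2))
card-CR (inj₂ refl ∷ os) (suc zero) = card-starts₂ {s = + 2} {+ 0} (λ ())
  (λ { (_ ∷ p) x@(here refl ∷ _ , _) → inj₁ (p , refl , path-tail refl x)
     ; (_ ∷ p) x@(there (here refl) ∷ _ , _) → inj₂ (p , refl , path-tail refl x)
     ; (_ ∷ p) (there (there (here refl)) ∷ _ , _ , (() , _) , _) })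
  (λ _ → path-∷ (here refl) (λ { _ (() , _) }) refl)
  (λ _ → path-∷ (there (here refl)) (λ { _ (() , _) }) refl)
  (card-CR os 3) (card-CR os 1)
card-CR (inj₂ refl ∷ os) (suc (suc h)) =
  card-starts₃ {s = + 2} {+ 0} { -[1+ 1 ]} (λ ()) (λ ()) (λ ())
  (λ { (_ ∷ p) x@(here refl ∷ _ , _) → inj₁ (p , refl , path-tail refl x)
     ; (_ ∷ p) x@(there (here refl) ∷ _ , _) → inj₂ (inj₁ (p , refl , path-tail stay x))
     ; (_ ∷ p) x@(there (there (here refl)) ∷ _ , _) → inj₂ (inj₂ (p , refl , path-tail refl x)) })
  (λ _ → path-∷ (here refl) (λ { _ (() , _) }) refl)
  (λ _ → path-∷ (there (here refl)) (λ { _ (() , _) }) stay)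
  (λ _ → path-∷ (there (there (here refl))) (λ { _ (() , _) }) refl)
  (card-CR os (suc (suc h) + 2)) (card-CR os (suc h + 1)) (card-CR os h)
  where
  stay : + suc (suc h) ℤ.+ + 0 ≡ + (suc h + 1)
  stay = ≡.trans (flat (suc (suc h))) (cong +_ (+-comm 1 (suc h)))

up : ∀ h → + h ℤ.+ + 1 ≡ + suc h
up h = cong +_ (+-comm h 1)

-- A Riordan path at height j is a walk by twos at height 2j.
card-Riordan : ∀ n j → Card (Path ⊤ (replicate n ±1,0) j) (W (replicate n 2) (j + j))
card-Riordan zero zero    = path-[]₀
card-Riordan zero (suc j) = path-[]₊
card-Riordan (suc n) zero = card-⇔
  (λ { _ (_ , refl , x) → path-∷ (here refl) (λ { _ (_ , ()) }) refl x })
  (λ { (_ ∷ p) x@(here refl ∷ _ , _) → p , refl , path-tail refl x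
     ; (_ ∷ p) (there (here refl) ∷ _ , nf , _) → ⊥-elim (proj₁ (nf tt) (refl , refl))
     ; (_ ∷ p) (there (there (here refl)) ∷ _ , _ , (() , _) , _) })
  (card-starts (+ 1) (card-Riordan n 1))
card-Riordan (suc n) (suc j) = card-size size
  (card-starts₃ {s = + 1} {+ 0} { -[1+ 0 ]} (λ ()) (λ ()) (λ ())
  (λ { (_ ∷ p) x@(here refl ∷ _ , _) → inj₁ (p , refl , path-tail (up (suc j)) x)
     ; (_ ∷ p) x@(there (here refl) ∷ _ , _) → inj₂ (inj₁ (p , refl , path-tail (flat (suc j)) x))
     ; (_ ∷ p) x@(there (there (here refl)) ∷ _ , _) → inj₂ (inj₂ (p , refl , path-tail refl x)) })
  (λ _ → path-∷ (here refl) (λ { _ (() , _) }) (up (suc j)))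
  (λ _ → path-∷ (there (here refl)) (λ { _ (() , _) }) (flat (suc j)))
  (λ _ → path-∷ (there (there (here refl))) (λ { _ (() , _) }) refl)
  (card-Riordan n (suc (suc j))) (card-Riordan n (suc j)) (card-Riordan n j))
  where
  V : ℕ → ℕ
  V = W (replicate n 2)
  size : V (suc (suc j) + suc (suc j)) + (V (suc j + suc j) + V (j + j)) ≡ U 2 V (suc j + suc j)
  size rewrite +-suc j j | +-suc j (suc j) | +-suc j j = sym (U₂-suc² V (j + j))

-- A Motzkin path at height j is a walk by twos at height 2j + 1, followed by one step to the axis.
card-Motzkin : ∀ n j → Card (Path ⊥ (replicate n ±1,0) j) (W (replicate n 2 ++ 1 ∷ []) (suc (j + j)))
card-Motzkin zero zero    = path-[]₀
card-Motzkin zero (suc j) = card-size (sym size) path-[]₊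
  where
  size : W (1 ∷ []) (suc (suc j + suc j)) ≡ 0
  size = U₁-suc (W []) (suc j + suc j)
card-Motzkin (suc n) zero = card-starts₂ {s = + 1} {+ 0} (λ ())
  (λ { (_ ∷ p) x@(here refl ∷ _ , _) → inj₁ (p , refl , path-tail refl x)
     ; (_ ∷ p) x@(there (here refl) ∷ _ , _) → inj₂ (p , refl , path-tail refl x)
     ; (_ ∷ p) (there (there (here refl)) ∷ _ , _ , (() , _) , _) })
  (λ _ → path-∷ (here refl) (λ ()) refl)
  (λ _ → path-∷ (there (here refl)) (λ ()) refl)
  (card-Motzkin n 1) (card-Motzkin n 0)
card-Motzkin (suc n) (suc j) = card-size size
  (card-starts₃ {s = + 1} {+ 0} { -[1+ 0 ]} (λ ()) (λ ()) (λ ())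
  (λ { (_ ∷ p) x@(here refl ∷ _ , _) → inj₁ (p , refl , path-tail (up (suc j)) x)
     ; (_ ∷ p) x@(there (here refl) ∷ _ , _) → inj₂ (inj₁ (p , refl , path-tail (flat (suc j)) x))
     ; (_ ∷ p) x@(there (there (here refl)) ∷ _ , _) → inj₂ (inj₂ (p , refl , path-tail refl x)) })
  (λ _ → path-∷ (here refl) (λ ()) (up (suc j)))
  (λ _ → path-∷ (there (here refl)) (λ ()) (flat (suc j)))
  (λ _ → path-∷ (there (there (here refl))) (λ ()) refl)
  (card-Motzkin n (suc (suc j))) (card-Motzkin n (suc j)) (card-Motzkin n j))
  where
  V : ℕ → ℕ
  V = W (replicate n 2 ++ 1 ∷ [])
  size : V (suc (suc (suc j) + suc (suc j))) + (V (suc (suc j + suc j)) + V (suc (j + j)))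
         ≡ U 2 V (suc (suc j + suc j))
  size rewrite +-suc j j | +-suc j (suc j) | +-suc j j = sym (U₂-suc² V (suc (j + j)))

pointwise-replicate⁺ : ∀ {S : List ℤ} {p} → All (_∈ S) p → Pointwise (λ S s → s ∈ S) (replicate (length p) S) p
pointwise-replicate⁺ []       = []
pointwise-replicate⁺ (i ∷ is) = i ∷ pointwise-replicate⁺ is

pointwise-replicate⁻ : ∀ {S : List ℤ} n {p} → Pointwise (λ S s → s ∈ S) (replicate n S) p →
                       length p ≡ n × All (_∈ S) p
pointwise-replicate⁻ zero    []       = refl , []
pointwise-replicate⁻ (suc n) (i ∷ is) with pointwise-replicate⁻ n is
... | e , a = cong suc e , i ∷ a

pointwise-split⁺ : ∀ {S T : List ℤ} a b {p} → length p ≡ a + b → All (_∈ S) (take a p) → All (_∈ T) (drop a p) →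
                   Pointwise (λ S s → s ∈ S) (replicate a S ++ replicate b T) p
pointwise-split⁺ zero    b refl []       ts = pointwise-replicate⁺ ts
pointwise-split⁺ (suc a) b {_ ∷ p} e (i ∷ is) ts = i ∷ pointwise-split⁺ a b (suc-injective e) is ts

pointwise-split⁻ : ∀ {S T : List ℤ} a b {p} → Pointwise (λ S s → s ∈ S) (replicate a S ++ replicate b T) p →
                   length p ≡ a + b × All (_∈ S) (take a p) × All (_∈ T) (drop a p)
pointwise-split⁻ zero    b is with pointwise-replicate⁻ b is
... | e , ts = e , [] , ts
pointwise-split⁻ (suc a) b (i ∷ is) with pointwise-split⁻ a b is
... | e , ss , ts = cong suc e , i ∷ ss , ts

map-steps-comp12 : ∀ a b → map steps (comp12 a b) ≡ replicate a ±1 ++ replicate b ±2,0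
map-steps-comp12 a b = ≡.trans (map-++ steps (replicate a 1) (replicate b 2))
  (cong₂ _++_ (map-replicate steps a 1) (map-replicate steps b 2))

unique-allSteps : Unique allSteps
unique-allSteps = from-yes (unique? allSteps)

count-paths : ∀ {P Q : List ℤ → Set} {N c} → (∀ p → P p → length p ≡ N × All (_∈ allSteps) p × Q p) →
              (∀ p → Q p → P p) → Card P c → Count Q (words allSteps N) c
count-paths {P} {Q} {N} to from = card⇒count (Listₚ.≡-dec ℤ._≟_) (unique-words unique-allSteps N)
  (λ p x → inWords p (to p x)) (λ p _ → from p)
  where
  inWords : ∀ p → length p ≡ N × All (_∈ allSteps) p × Q p → p ∈ words allSteps N × Q p
  inWords p (refl , is , q) = ∈-words⁺ is , q

∈±1⇒∈allSteps : ∀ {s} → s ∈ ±1 → s ∈ allSteps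
∈±1⇒∈allSteps (here e)         = there (here e)
∈±1⇒∈allSteps (there (here e)) = there (there (there (here e)))

∈±2,0⇒∈allSteps : ∀ {s} → s ∈ ±2,0 → s ∈ allSteps
∈±2,0⇒∈allSteps (here e)                 = here e
∈±2,0⇒∈allSteps (there (here e))         = there (there (here e))
∈±2,0⇒∈allSteps (there (there (here e))) = there (there (there (there (here e))))

∈±1,0⇒∈allSteps : ∀ {s} → s ∈ ±1,0 → s ∈ allSteps
∈±1,0⇒∈allSteps (here e)                 = there (here e)
∈±1,0⇒∈allSteps (there (here e))         = there (there (here e))
∈±1,0⇒∈allSteps (there (there (here e))) = there (there (there (here e)))

count-CR : ∀ n k → k ≤ n → CRCount n k (W (comp12 (2 * k) (n ∸ k)) 0)
count-CR n k k≤n = count-paths to from (card-CR (oneOrTwo-comp12 (2 * k) (n ∸ k)) 0)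
  where
  len : 2 * k + (n ∸ k) ≡ n + k
  len = ≡.trans (lemma k (n ∸ k)) (cong (_+ k) (m∸n+n≡m k≤n))
    where
    lemma : ∀ k d → 2 * k + d ≡ d + k + k
    lemma = solve-∀
  to : ∀ p → Path ⊤ (map steps (comp12 (2 * k) (n ∸ k))) 0 p →
       length p ≡ n + k × All (_∈ allSteps) p × IsCRPath n k p
  to p (pw , nf , nb , e)
    with pointwise-split⁻ (2 * k) (n ∸ k) (subst (λ x → Pointwise _ x p) (map-steps-comp12 (2 * k) (n ∸ k)) pw)
  ... | l , ss , ts = l′ , All-allSteps , (l′ , ss , ts , nf tt , nb , ≡.trans (sym (ℤₚ.+-identityˡ _)) e)
    where
    l′ : length p ≡ n + k
    l′ = ≡.trans l len
    All-allSteps : All (_∈ allSteps) p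
    All-allSteps = subst (All (_∈ allSteps)) (Listₚ.take++drop≡id (2 * k) p)
      (Allₚ.++⁺ (All.map ∈±1⇒∈allSteps ss) (All.map ∈±2,0⇒∈allSteps ts))
  from : ∀ p → IsCRPath n k p → Path ⊤ (map steps (comp12 (2 * k) (n ∸ k))) 0 p
  from p (l , ss , ts , nf , nb , e) =
    subst (λ x → Pointwise _ x p) (sym (map-steps-comp12 (2 * k) (n ∸ k)))
      (pointwise-split⁺ (2 * k) (n ∸ k) (≡.trans l (sym len)) ss ts) ,
    (λ _ → nf) , nb , ≡.trans (ℤₚ.+-identityˡ _) e

motzkin⁺ : ∀ {F} n p → Path F (replicate n ±1,0) 0 p → length p ≡ n × All (_∈ allSteps) p × IsMotzkin n p
motzkin⁺ n p (pw , _ , nb , e) with pointwise-replicate⁻ n pw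
... | l , ss = l , All.map ∈±1,0⇒∈allSteps ss , (l , ss , nb , ≡.trans (sym (ℤₚ.+-identityˡ _)) e)

motzkin⁻ : ∀ {F} n p → (F → NoFlatOnAxis (+ 0) p) → IsMotzkin n p → Path F (replicate n ±1,0) 0 p
motzkin⁻ n p nf (refl , ss , nb , e) = pointwise-replicate⁺ ss , nf , nb , ≡.trans (ℤₚ.+-identityˡ _) e

count-Riordan : ∀ n → RCount n (W (comp12 0 n) 0)
count-Riordan n = count-paths
  (λ p x → let l , a , m = motzkin⁺ n p x in l , a , m , proj₁ (proj₂ x) tt)
  (λ { p (m , nf) → motzkin⁻ n p (λ _ → nf) m }) (card-Riordan n 0)

-- The first factor V₁ lifts height 0 to 1, where the walk on odd heights begins; the second is
-- commuted to the end, where it brings height 1 back to 0.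
count-Motzkin : ∀ n → MCount n (W (comp12 2 n) 0)
count-Motzkin n = count-paths (motzkin⁺ n) (λ p → motzkin⁻ n p (λ ()))
  (card-size (sym (U-cong 1 (λ h → ≡.trans (cong (λ x → W (1 ∷ x) h) (sym (Listₚ.++-identityʳ (replicate n 2)))) (sym (W-pull (inj₁ refl) (replicate n 2) [] h))) 0)) (card-Motzkin n 0))

-- The equalities of the theorem

count-S-comp12 : ∀ {n} m₁ n₁ m₂ n₂ π → m₁ + 2 * n₁ ≡ n → m₂ + 2 * n₂ ≡ n →
                 SCount (comp12 m₁ n₁) (comp12 m₂ n₂) π (W (comp12 (m₁ + m₂) (n₁ + n₂)) 0)
count-S-comp12 m₁ n₁ m₂ n₂ π e₁ e₂ = subst (SCount (comp12 m₁ n₁) (comp12 m₂ n₂) π) (W-comp12-++ m₁ n₁ m₂ n₂ 0)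
  (count-S π (comp12 m₁ n₁) (comp12 m₂ n₂) (oneOrTwo-comp12 m₁ n₁) (oneOrTwo-comp12 m₂ n₂)
    (≡.trans (sum-comp12 m₁ n₁) (≡.trans e₁ (≡.trans (sym e₂) (sym (sum-comp12 m₂ n₂))))))

-- Adding the sizes of α and β and halving shows both that k ≤ n and that α and β together contain n
-- - k twos.
n₁+n₂+k≡n : ∀ n k m₁ n₁ m₂ n₂ → m₁ + 2 * n₁ ≡ n → m₂ + 2 * n₂ ≡ n → m₁ + m₂ ≡ 2 * k → n₁ + n₂ + k ≡ n
n₁+n₂+k≡n n k m₁ n₁ m₂ n₂ e₁ e₂ e = *-cancelˡ-≡ _ _ 2 (begin
  2 * (n₁ + n₂ + k)                    ≡⟨ *-distribˡ-+ 2 (n₁ + n₂) k ⟩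
  2 * (n₁ + n₂) + 2 * k                ≡⟨ cong (λ x → 2 * (n₁ + n₂) + x) (sym e) ⟩
  2 * (n₁ + n₂) + (m₁ + m₂)            ≡⟨ regroup m₁ n₁ m₂ n₂ ⟩
  (m₁ + 2 * n₁) + (m₂ + 2 * n₂)        ≡⟨ cong₂ _+_ e₁ e₂ ⟩
  n + n                                ≡⟨ double n ⟩
  2 * n                                ∎)
  where
  open ≡-Reasoning
  regroup : ∀ a b c d → 2 * (b + d) + (a + c) ≡ (a + 2 * b) + (c + 2 * d)
  regroup = solve-∀
  double : ∀ n → n + n ≡ 2 * n
  double = solve-∀

theorem3p6 : ((n k m₁ n₁ m₂ n₂ : ℕ) → m₁ + 2 * n₁ ≡ n → m₂ + 2 * n₂ ≡ n → m₁ + m₂ ≡ 2 * k →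
    (π : Permutation′ 3) →
    Σ ℕ λ c →
    (+ c ≡ D^ (n ∸ k) catalan n) ×
    CRCount n k c ×
    KCount (n ∷ n ∷ []) (comp12 (2 * k) (n ∸ k)) c ×
    SCount (comp12 m₁ n₁) (comp12 m₂ n₂) π c)
    × ((n : ℕ) → Σ ℕ λ c → MCount n c × KCount (suc n ∷ suc n ∷ []) (comp12 2 n) c)
    × ((n : ℕ) → Σ ℕ λ c → RCount n c × KCount (n ∷ n ∷ []) (comp12 0 n) c)
    × ((n : ℕ) (π : Permutation′ 3) →
    Σ ℕ λ c → MCount (2 * n) c × SCount (comp12 1 n) (comp12 1 n) π c)
    × ((n : ℕ) (π : Permutation′ 3) →
    Σ ℕ λ c → RCount (2 * n) c × SCount (comp12 0 n) (comp12 0 n) π c)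
theorem3p6 = general ,
  (λ n → W (comp12 2 n) 0 , count-Motzkin n , count-K (suc n) (comp12 2 n) (≡.trans (sum-comp12 2 n) (double₂ n))) ,
  (λ n → W (comp12 0 n) 0 , count-Riordan n , count-K n (comp12 0 n) (≡.trans (sum-comp12 0 n) (double n))) ,
  (λ n π → W (comp12 2 (2 * n)) 0 , count-Motzkin (2 * n) ,
    subst (λ x → SCount (comp12 1 n) (comp12 1 n) π (W (comp12 2 x) 0)) (sym (double n))
      (count-S-comp12 1 n 1 n π refl refl)) ,
  (λ n π → W (comp12 0 (2 * n)) 0 , count-Riordan (2 * n) ,
    subst (λ x → SCount (comp12 0 n) (comp12 0 n) π (W (comp12 0 x) 0)) (sym (double n))
      (count-S-comp12 0 n 0 n π refl refl))
  where
  double : ∀ n → 2 * n ≡ n + n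
  double = solve-∀
  double₂ : ∀ n → 2 + 2 * n ≡ suc n + suc n
  double₂ = solve-∀
  general : (n k m₁ n₁ m₂ n₂ : ℕ) → m₁ + 2 * n₁ ≡ n → m₂ + 2 * n₂ ≡ n → m₁ + m₂ ≡ 2 * k →
    (π : Permutation′ 3) → Σ ℕ λ c → (+ c ≡ D^ (n ∸ k) catalan n) × CRCount n k c ×
    KCount (n ∷ n ∷ []) (comp12 (2 * k) (n ∸ k)) c × SCount (comp12 m₁ n₁) (comp12 m₂ n₂) π c
  general n k m₁ n₁ m₂ n₂ e₁ e₂ e π =
    W (comp12 (2 * k) (n ∸ k)) 0 ,
    subst (λ x → + W (comp12 (2 * k) (n ∸ k)) 0 ≡ D^ (n ∸ k) catalan x) (m+[n∸m]≡n k≤n) (D^-catalan (n ∸ k) k) ,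
    count-CR n k k≤n ,
    count-K n (comp12 (2 * k) (n ∸ k)) total ,
    subst (SCount (comp12 m₁ n₁) (comp12 m₂ n₂) π) (cong₂ (λ x y → W (comp12 x y) 0) e twos)
      (count-S-comp12 m₁ n₁ m₂ n₂ π e₁ e₂)
    where
    n≡ : n₁ + n₂ + k ≡ n
    n≡ = n₁+n₂+k≡n n k m₁ n₁ m₂ n₂ e₁ e₂ e
    k≤n : k ≤ n
    k≤n = ≤-trans (m≤n+m k (n₁ + n₂)) (≤-reflexive n≡)
    twos : n₁ + n₂ ≡ n ∸ k
    twos = ≡.trans (sym (m+n∸n≡m (n₁ + n₂) k)) (cong (_∸ k) n≡)
    total : sum (comp12 (2 * k) (n ∸ k)) ≡ n + n
    total = begin
      sum (comp12 (2 * k) (n ∸ k))   ≡⟨ sum-comp12 (2 * k) (n ∸ k) ⟩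
      2 * k + 2 * (n ∸ k)            ≡⟨ sym (*-distribˡ-+ 2 k (n ∸ k)) ⟩
      2 * (k + (n ∸ k))              ≡⟨ cong (λ x → 2 * x) (m+[n∸m]≡n k≤n) ⟩
      2 * n                          ≡⟨ double n ⟩
      n + n                          ∎
      where open ≡-Reasoning
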